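{- Let $m,n\ge 2$ be integers. There exists a ${}^{2}\mathrm{H}(m,n;n,m)$ if and only if $mn\not\equiv 1\pmod 4$ and $m,n$ are not both equal to $2$.
   Context: A partially filled (p.f.) array is a matrix in which some cells may be empty. ${}^{2}\mathrm{H}(m,n;n,m)$ denotes an $m\times n$ array with entries in $\mathbb{Z}_{mn+1}$ such that: (a) each row has exactly $n$ filled cells and each column exactly $m$ filled cells (i.e. no cell is empty); (b) the multiset $\{\pm x : x \text{ an entry}\}$ (with multiplicity) contains each nonzero element of $\mathbb{Z}_{mn+1}$ exactly $2$ times; (c) every row and column sums to $0$ in $\mathbb{Z}_{mn+1}$. -}

module Defs where

open import Data.Nat using (ℕ; zero; suc; _+_; _*_; _<_; _≡ᵇ_)
open import Data.Nat.DivMod using (_%_)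
open import Data.Fin using (Fin; zero; suc)
open import Data.Bool using (if_then_else_)
open import Data.Product using (Σ; _×_; ∃)
open import Relation.Binary.PropositionalEquality using (_≡_)
open import Relation.Nullary using (¬_)

sumFin : (k : ℕ) → (Fin k → ℕ) → ℕ
sumFin zero    f = 0
sumFin (suc k) f = f zero + sumFin k (λ i → f (suc i))

-- Elements of ℤ_v are represented by naturals < v; the modulus is v = m*n+1.
-- An m×n array with entries in ℤ_{mn+1}.
Array : ℕ → ℕ → Set
Array m n = Fin m → Fin n → ℕ


countEq : (m n v : ℕ) → Array m n → ℕ → ℕ
countEq m n v A x =
  sumFin m (λ i → sumFin n (λ j → if (A i j ≡ᵇ x) then 1 else 0))

countNeg : (m n v : ℕ) .{{_ : Data.Nat.NonZero v}} → Array m n → ℕ → ℕ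
countNeg m n v A x =
  sumFin m (λ i → sumFin n (λ j → if (((A i j + x) % v) ≡ᵇ 0) then 1 else 0))

-- ²H(m,n;n,m): an m×n array (no empty cell, so each row has n and each
-- column m filled cells) with entries in ℤ_{mn+1} such that
--  (b) the multiset {±x : x an entry} contains every nonzero element of
--      ℤ_{mn+1} exactly twice, i.e. for each nonzero y,
--      #{cells with entry y} + #{cells with entry -y} = 2;
--  (c) every row and every column sums to 0 in ℤ_{mn+1}.
record IsH2 (m n : ℕ) (A : Array m n) : Set where
  field
    entries<   : ∀ i j → A i j < suc (m * n)
    covering   : ∀ y → 0 < y → y < suc (m * n) →
                 countEq m n (suc (m * n)) A y + countNeg m n (suc (m * n)) A y ≡ 2
    rowSum     : ∀ i → sumFin n (λ j → A i j) % suc (m * n) ≡ 0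
    colSum     : ∀ j → sumFin m (λ i → A i j) % suc (m * n) ≡ 0

H2Exists : ℕ → ℕ → Set
H2Exists m n = Σ (Array m n) (IsH2 m n)

{-# OPTIONS --safe #-}
module Submission where

-- Sufficiency.  Work with integer entries ± x whose absolute values cover 1 … N twice, where N = ⌊ mn / 2 ⌋
-- (and v / 2 once if mn is odd).  A zero-sum row r may be followed by - r, and then the columns cancel.
-- So if m is even and n > 2, and if n is even or m = 2, it is enough to cut 1 … N into m / 2 sets of n numbers
-- with signed sum 0 mod v.  Otherwise transpose so that m is odd, and m ≡ 3 (mod 4) if n is odd too.  All rows
-- but three are paired in this way, and the columns of the three remaining rows are paired as well, except for
-- a core of at most eight columns whose rows and columns sum to zero.  The paired columns have the form
-- ± (s , x , - (x + s)); they come from two nests of concentric pairs (x , x + s), one for the odd and one for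
-- the even s.  Each nest leaves a gap in its centre, and the core uses exactly the numbers in these gaps and a
-- few next to the nests.  If n is odd, the paired rows have odd length and take triples of the nests as well.
--
-- Necessity.  If mn ≡ 1 (mod 4) then v / 2 is odd and equals the number of odd entries, although the total is
-- even.

open import Defs
import Algebra.Solver.CommutativeMonoid as MonoidSolver
open import Data.Bool using (true; false; if_then_else_)
open import Data.Empty using (⊥-elim)
open import Data.Fin using (Fin; zero; suc; toℕ; fromℕ<)
open import Data.Fin.Properties using (all?; toℕ-fromℕ<; toℕ<n)
open import Data.List using (List; []; _∷_; _++_; [_]; map; length; concat; concatMap; iterate)
open import Data.List.Properties
  using (map-++; length-map; length-++; concatMap-++; map-∘; ++-assoc; ++-identityʳ)
open import Data.List.Relation.Binary.Permutation.Propositional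
  using (_↭_; ↭-refl; ↭-sym; ↭-trans; ↭-reflexive; module PermutationReasoning)
import Data.List.Relation.Binary.Permutation.Propositional.Properties as ↭ₚ
open import Data.List.Relation.Unary.All using (All; []; _∷_)
import Data.List.Relation.Unary.All as All
import Data.List.Relation.Unary.All.Properties as Allₚ
open import Data.Nat
open import Data.Nat.DivMod
open import Data.Nat.ListAction using (sum)
open import Data.Nat.ListAction.Properties using (sum-++; sum-↭)
open import Data.Nat.Properties
open import Data.Nat.Tactic.RingSolver using (solve-∀)
open import Data.Product using (∃; ∃₂; _×_; _,_; proj₁; proj₂)
open import Data.Unit using (tt)
open import Function using (_∘_)
open import Function.Bundles using (_⇔_; mk⇔)
open import Relation.Binary.Definitions using (Tri; tri<; tri≈; tri>)
open import Relation.Binary.PropositionalEquality hiding ([_])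
open import Relation.Nullary using (¬_; Dec; yes; no)
open import Relation.Nullary.Decidable using (from-yes; _→-dec_; ¬?)

-- Equality tests and finite sums

≡ᵇ-true : ∀ {a b} → a ≡ b → (a ≡ᵇ b) ≡ true
≡ᵇ-true {a} {b} a≡b with a ≡ᵇ b | ≡⇒≡ᵇ a b a≡b
... | true | _ = refl

≡ᵇ-false : ∀ {a b} → ¬ a ≡ b → (a ≡ᵇ b) ≡ false
≡ᵇ-false {a} {b} a≢b with a ≡ᵇ b | ≡ᵇ⇒≡ a b
... | true  | sound = ⊥-elim (a≢b (sound tt))
... | false | _     = refl

≡ᵇ-cong : ∀ a b c d → (a ≡ b → c ≡ d) → (c ≡ d → a ≡ b) → (a ≡ᵇ b) ≡ (c ≡ᵇ d)
≡ᵇ-cong a b _ _ f g with a ≟ b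
... | yes a≡b = trans (≡ᵇ-true a≡b) (sym (≡ᵇ-true (f a≡b)))
... | no  a≢b = trans (≡ᵇ-false a≢b) (sym (≡ᵇ-false (a≢b ∘ g)))

-- The only multiple of `v` strictly between 0 and `2v` is `v` itself. This turns the congruence
-- tested by `countNeg` into an equation of naturals.
%-zero : ∀ {s v} .{{_ : NonZero v}} → 0 < s → s < v + v → ((s % v) ≡ᵇ 0) ≡ (s ≡ᵇ v)
%-zero {s} {v} 0<s s<2v = ≡ᵇ-cong (s % v) 0 s v forth (λ { refl → n%n≡0 v })
  where
  forth : s % v ≡ 0 → s ≡ v
  forth eq with s <? v
  ... | yes s<v = ⊥-elim (<⇒≢ 0<s (sym (trans (sym (m<n⇒m%n≡m s<v)) eq)))
  ... | no  s≮v with m≤n⇒∃[o]m+o≡n (≮⇒≥ s≮v)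
  ...   | o , refl = begin
    v + o              ≡⟨ cong (v +_) (sym (m<n⇒m%n≡m (+-cancelˡ-< v o v s<2v))) ⟩
    v + o % v          ≡⟨ cong (v +_) (sym ([m+n]%n≡m%n o v)) ⟩
    v + (o + v) % v    ≡⟨ cong (λ x → v + x % v) (+-comm o v) ⟩
    v + (v + o) % v    ≡⟨ cong (v +_) eq ⟩
    v + 0              ≡⟨ +-identityʳ v ⟩
    v                  ∎
    where open ≡-Reasoning

sumFin-cong : ∀ k {f g : Fin k → ℕ} → (∀ i → f i ≡ g i) → sumFin k f ≡ sumFin k g
sumFin-cong zero    f≗g = refl
sumFin-cong (suc k) f≗g = cong₂ _+_ (f≗g zero) (sumFin-cong k (f≗g ∘ suc))

interchange : ∀ a b c d → (a + b) + (c + d) ≡ (a + c) + (b + d)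
interchange = solve-∀

sumFin-+ : ∀ k (f g : Fin k → ℕ) → sumFin k f + sumFin k g ≡ sumFin k (λ i → f i + g i)
sumFin-+ zero    f g = refl
sumFin-+ (suc k) f g =
  trans (interchange (f zero) _ (g zero) _)
        (cong (f zero + g zero +_) (sumFin-+ k (f ∘ suc) (g ∘ suc)))

sumFin-0 : ∀ k → sumFin k (λ _ → 0) ≡ 0
sumFin-0 zero    = refl
sumFin-0 (suc k) = sumFin-0 k

sumFin-swap : ∀ m n (f : Fin m → Fin n → ℕ) →
  sumFin m (λ i → sumFin n (f i)) ≡ sumFin n (λ j → sumFin m (λ i → f i j))
sumFin-swap zero    n f = sym (sumFin-0 n)
sumFin-swap (suc m) n f =
  trans (cong (sumFin n (f zero) +_) (sumFin-swap m n (f ∘ suc)))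
        (sumFin-+ n (f zero) _)

-- The conditions are symmetric in rows and columns. Only the modulus, written `m * n` or `n * m`,
-- and the order of summation have to be changed.
transposeH2 : ∀ {m n} → H2Exists m n → H2Exists n m
transposeH2 {m} {n} (A , isH2) = (λ j i → A i j) , record
  { entries<   = λ j i → subst (λ v → A i j < suc v) (*-comm m n) (entries< i j)
  ; covering   = λ y 0<y y<v →
      trans (cong₂ _+_ (sumFin-swap n m _) (sumFin-swap n m _))
            (subst (λ v → y < suc v → countEq m n (suc v) A y + countNeg m n (suc v) A y ≡ 2)
                   (*-comm m n) (covering y 0<y) y<v)
  ; rowSum     = λ j → subst (λ v → sumFin m (λ i → A i j) % suc v ≡ 0) (*-comm m n) (colSum j)
  ; colSum     = λ i → subst (λ v → sumFin n (λ j → A i j) % suc v ≡ 0) (*-comm m n) (rowSum i)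
  }
  where open IsH2 isH2

-- Signed rows and their residues

-- With explicit signs, opposite rows and zero sums are handled over the integers; `residue` passes
-- to the representatives below `v` only when the array is formed.
data Signed : Set where
  pos neg : ℕ → Signed

Row : Set
Row = List Signed

∣_∣ : Signed → ℕ
∣ pos n ∣ = n
∣ neg n ∣ = n

opposite : Signed → Signed
opposite (pos n) = neg n
opposite (neg n) = pos n

residue : ℕ → Signed → ℕ
residue v (pos n) = n
residue v (neg n) = v ∸ n

posPart negPart : Signed → ℕ
posPart (pos n) = n
posPart (neg n) = 0
negPart (pos n) = 0
negPart (neg n) = n

posSum negSum : Row → ℕ
posSum r = sum (map posPart r)
negSum r = sum (map negPart r)

ZeroSum : Row → Set
ZeroSum r = posSum r ≡ negSum r

-- Signed sum 0 modulo `v`, without subtraction. Multiples are allowed on both sides, so a change of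
-- all signs just exchanges the two witnesses.
Balanced : ℕ → Row → Set
Balanced v r = ∃₂ λ a b → posSum r + a * v ≡ negSum r + b * v

zeroSum⇒balanced : ∀ {v r} → ZeroSum r → Balanced v r
zeroSum⇒balanced eq = 0 , 0 , cong (_+ 0) eq

InRange : ℕ → ℕ → Set
InRange v x = 0 < x × x < v

-- A negative entry is represented by `v ∸ n`, which exceeds its signed value by `v`; so `k` is the
-- number of negative entries.
residue-sum : ∀ {v} r → All (λ s → ∣ s ∣ < v) r →
  ∃ λ k → sum (map (residue v) r) + negSum r ≡ posSum r + k * v
residue-sum []          []       = 0 , refl
residue-sum (pos n ∷ r) (_ ∷ ps) with residue-sum r ps
... | k , eq = k , trans (+-assoc n _ _) (trans (cong (n +_) eq) (sym (+-assoc n _ _)))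
residue-sum {v} (neg n ∷ r) (n<v ∷ ps) with residue-sum r ps
... | k , eq = suc k , (begin
  (v ∸ n + S) + (n + negSum r)    ≡⟨ interchange (v ∸ n) S n _ ⟩
  (v ∸ n + n) + (S + negSum r)    ≡⟨ cong₂ _+_ (m∸n+n≡m (<⇒≤ n<v)) eq ⟩
  v + (posSum r + k * v)          ≡⟨ shuffle v (posSum r) k ⟩
  posSum r + suc k * v            ∎)
  where
  open ≡-Reasoning
  S = sum (map (residue v) r)
  shuffle : ∀ v p k → v + (p + k * v) ≡ p + (v + k * v)
  shuffle = solve-∀

-- After `negSum r` is added to both sides, `residue-sum` and the balance show that the residue sum
-- plus `a * v` is `(b + k) * v`.
balanced⇒sum%≡0 : ∀ {v} .{{_ : NonZero v}} r → All (λ s → ∣ s ∣ < v) r → Balanced v r →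
  sum (map (residue v) r) % v ≡ 0
balanced⇒sum%≡0 {v} r ps (a , b , bal) with residue-sum r ps
... | k , eq = begin
  S % v                    ≡⟨ [m+kn]%n≡m%n S a v ⟨
  (S + a * v) % v          ≡⟨ cong (_% v) (+-cancelʳ-≡ (negSum r) _ _ lem) ⟩
  ((b + k) * v) % v        ≡⟨ m*n%n≡0 (b + k) v ⟩
  0                        ∎
  where
  open ≡-Reasoning
  S = sum (map (residue v) r)
  sh₁ : ∀ s a q → (s + a) + q ≡ (s + q) + a
  sh₁ = solve-∀
  sh₂ : ∀ q b k v → (q + b * v) + k * v ≡ (b + k) * v + q
  sh₂ = solve-∀
  lem : (S + a * v) + negSum r ≡ (b + k) * v + negSum r
  lem = begin
    (S + a * v) + negSum r           ≡⟨ sh₁ S (a * v) _ ⟩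
    (S + negSum r) + a * v           ≡⟨ cong (_+ a * v) eq ⟩
    (posSum r + k * v) + a * v       ≡⟨ sh₁ (posSum r) _ _ ⟩
    (posSum r + a * v) + k * v       ≡⟨ cong (_+ k * v) bal ⟩
    (negSum r + b * v) + k * v       ≡⟨ sh₂ (negSum r) b k v ⟩
    (b + k) * v + negSum r           ∎

nth : {A : Set} → A → List A → ℕ → A
nth d []       _       = d
nth d (x ∷ xs) zero    = x
nth d (x ∷ xs) (suc i) = nth d xs i

nth-All : {A : Set} {P : A → Set} {d : A} {xs : List A} → P d → All P xs → ∀ i → P (nth d xs i)
nth-All pd []        i       = pd
nth-All pd (px ∷ ps) zero    = px
nth-All pd (px ∷ ps) (suc i) = nth-All pd ps i

nth-All< : {A : Set} {P : A → Set} {d : A} {xs : List A} → All P xs → ∀ i → i < length xs → P (nth d xs i)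
nth-All< (px ∷ ps) zero    _         = px
nth-All< (px ∷ ps) (suc i) (s≤s i<n) = nth-All< ps i i<n

sumFin-nth : {A : Set} {k : ℕ} (d : A) (f : A → ℕ) (xs : List A) → length xs ≡ k →
  sumFin k (λ i → f (nth d xs (toℕ i))) ≡ sum (map f xs)
sumFin-nth d f []       refl = refl
sumFin-nth d f (x ∷ xs) refl = cong (f x +_) (sumFin-nth d f xs refl)

entry : Row → ℕ → Signed
entry = nth (pos 0)

column : List Row → ℕ → Row
column rows j = map (λ r → entry r j) rows

gridSum : ∀ {m n} (f : Signed → ℕ) rows → length rows ≡ m → All (λ r → length r ≡ n) rows →
  sumFin m (λ i → sumFin n (λ j → f (entry (nth [] rows (toℕ i)) (toℕ j)))) ≡ sum (map f (concat rows))
gridSum f []         refl []       = refl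
gridSum f (r ∷ rows) refl (l ∷ ls) = begin
  _                                           ≡⟨ cong₂ _+_ (sumFin-nth (pos 0) f r l) (gridSum f rows refl ls) ⟩
  sum (map f r) + sum (map f (concat rows))   ≡⟨ sum-++ (map f r) _ ⟨
  sum (map f r ++ map f (concat rows))        ≡⟨ cong sum (map-++ f r (concat rows)) ⟨
  sum (map f (r ++ concat rows))              ∎
  where open ≡-Reasoning

absolutes : List Row → List ℕ
absolutes rows = map ∣_∣ (concat rows)

-- How often `± x` equals `y` modulo `v`: `x` is `y`, or `x` is the complement `v - y`. Both happen
-- when `y` is half of `v`.
hits : ℕ → ℕ → ℕ → ℕ
hits v y x = (if x ≡ᵇ y then 1 else 0) + (if x + y ≡ᵇ v then 1 else 0)

-- The covering condition in terms of absolute values alone. It is invariant under permutation, so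
-- signs and positions in the array no longer matter.
TwoFold : ℕ → List ℕ → Set
TwoFold v xs = All (InRange v) xs × (∀ y y′ → 0 < y → 0 < y′ → y + y′ ≡ v → sum (map (hits v y) xs) ≡ 2)

TwoFold-resp-↭ : ∀ {v xs ys} → xs ↭ ys → TwoFold v xs → TwoFold v ys
TwoFold-resp-↭ p (ranges , covers) =
  ↭ₚ.All-resp-↭ p ranges , λ y y′ 0<y 0<y′ eq → trans (sum-↭ (↭ₚ.map⁺ _ (↭-sym p))) (covers y y′ 0<y 0<y′ eq)

-- A change of sign exchanges the test for `y` with the test for `-y`, so the contribution of a cell
-- depends only on its absolute value.
residue-hits : ∀ {v y} .{{_ : NonZero v}} → 0 < y → y < v → ∀ s → InRange v ∣ s ∣ →
  (if residue v s ≡ᵇ y then 1 else 0) + (if (((residue v s + y) % v) ≡ᵇ 0) then 1 else 0) ≡ hits v y ∣ s ∣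
residue-hits {v} {y} 0<y y<v (pos n) (0<n , n<v) =
  cong (λ b → (if n ≡ᵇ y then 1 else 0) + (if b then 1 else 0))
       (%-zero (<-≤-trans 0<n (m≤m+n n y)) (+-mono-< n<v y<v))
residue-hits {v} {y} 0<y y<v (neg n) (0<n , n<v) =
  trans (cong₂ (λ b c → (if b then 1 else 0) + (if c then 1 else 0)) eq₁ eq₂)
        (+-comm (if n + y ≡ᵇ v then 1 else 0) _)
  where
  v∸n+n = m∸n+n≡m (<⇒≤ n<v)
  eq₁ : (v ∸ n ≡ᵇ y) ≡ (n + y ≡ᵇ v)
  eq₁ = ≡ᵇ-cong (v ∸ n) y (n + y) v (λ { refl → m+[n∸m]≡n (<⇒≤ n<v) }) (λ { refl → m+n∸m≡n n y })
  eq₂ : ((((v ∸ n) + y) % v) ≡ᵇ 0) ≡ (n ≡ᵇ y)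
  eq₂ = trans (%-zero (<-≤-trans 0<y (m≤n+m y (v ∸ n)))
                      (+-mono-≤-< (m∸n≤m v n) y<v))
              (≡ᵇ-cong ((v ∸ n) + y) v n y (λ e → +-cancelˡ-≡ (v ∸ n) n y (trans v∸n+n (sym e)))
                       (λ { refl → v∸n+n }))

-- The passage from lists of signed rows to arrays of residues; all constructions end here.
realise : ∀ {m n} (rows : List Row) → length rows ≡ m → All (λ r → length r ≡ n) rows →
  All (Balanced (suc (m * n))) rows → (∀ j → j < n → Balanced (suc (m * n)) (column rows j)) →
  TwoFold (suc (m * n)) (absolutes rows) → H2Exists m n
realise {m} {n} rows height widths rowsBal colsBal twoFold = A , record
  { entries< = λ i j →
      -- The defaults, the entry zero and the empty row, satisfy the bound too, so no index is
      -- compared with a length.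
      nth-All {P = λ s → residue v s < v} (s≤s z≤n)
        (nth-All {P = All (λ s → residue v s < v)} {xs = rows} []
          (All.map (All.map (λ {s} → residue< s)) (Allₚ.concat⁻ inRange)) (toℕ i))
        (toℕ j)
  ; covering = λ y 0<y y<v →
      let isY s    = if residue v s ≡ᵇ y then 1 else 0
          isNegY s = if (((residue v s + y) % v) ≡ᵇ 0) then 1 else 0
      in begin
      countEq m n v A y + countNeg m n v A y
        ≡⟨ cong₂ _+_ (gridSum isY rows height widths) (gridSum isNegY rows height widths) ⟩
      sum (map isY (concat rows)) + sum (map isNegY (concat rows))
        ≡⟨ sum-map-+ (concat rows) (All.map (λ {s} → residue-hits 0<y y<v s) inRange) ⟩
      sum (map (hits v y ∘ ∣_∣) (concat rows))
        ≡⟨ cong sum (map-∘ (concat rows)) ⟩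
      sum (map (hits v y) (absolutes rows))
        ≡⟨ proj₂ twoFold y (v ∸ y) 0<y (m<n⇒0<n∸m y<v) (m+[n∸m]≡n (<⇒≤ y<v)) ⟩
      2 ∎
  ; rowSum = λ i →
      nth-All< {P = λ r → sumFin n (λ j → residue v (entry r (toℕ j))) % v ≡ 0}
        rowSums (toℕ i) (subst (toℕ i <_) (sym height) (toℕ<n i))
  ; colSum = λ j → begin
      sumFin m (λ i → A i j) % v
        ≡⟨ cong (_% v) (sumFin-nth [] (λ r → residue v (entry r (toℕ j))) rows height) ⟩
      sum (map (λ r → residue v (entry r (toℕ j))) rows) % v
        ≡⟨ cong (λ xs → sum xs % v) (map-∘ rows) ⟩
      sum (map (residue v) (column rows (toℕ j))) % v
        ≡⟨ balanced⇒sum%≡0 (column rows (toℕ j))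
             (Allₚ.map⁺ (All.map (λ ps → nth-All (s≤s z≤n) ps (toℕ j)) small))
             (colsBal (toℕ j) (toℕ<n j)) ⟩
      0 ∎
  }
  where
  open ≡-Reasoning
  v = suc (m * n)
  A : Array m n
  A i j = residue v (entry (nth [] rows (toℕ i)) (toℕ j))
  inRange : All (λ s → InRange v ∣ s ∣) (concat rows)
  inRange = Allₚ.map⁻ (proj₁ twoFold)
  small : All (All (λ s → ∣ s ∣ < v)) rows
  small = Allₚ.concat⁻ (All.map proj₂ inRange)
  residue< : ∀ s → InRange v ∣ s ∣ → residue v s < v
  residue< (pos n) (_ , n<v)   = n<v
  residue< (neg n) (0<n , n<v) = ∸-monoʳ-< 0<n (<⇒≤ n<v)
  sum-map-+ : ∀ {f g h : Signed → ℕ} xs → All (λ s → f s + g s ≡ h s) xs →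
    sum (map f xs) + sum (map g xs) ≡ sum (map h xs)
  sum-map-+ []       []       = refl
  sum-map-+ {f} {g} (x ∷ xs) (e ∷ es) =
    trans (interchange (f x) _ (g x) _) (cong₂ _+_ e (sum-map-+ xs es))
  rowSums : All (λ r → sumFin n (λ j → residue v (entry r (toℕ j))) % v ≡ 0) rows
  rowSums = All.zipWith
    (λ { {r} (l , ps , bal) → trans (cong (_% v) (sumFin-nth (pos 0) (residue v) r l)) (balanced⇒sum%≡0 r ps bal) })
    (widths , All.zip (small , rowsBal))

-- Ranges and nests

range : ℕ → ℕ → List ℕ
range = iterate suc

range-++ : ∀ a k l → range a (k + l) ≡ range a k ++ range (a + k) l
range-++ a zero    l = cong (λ b → range b l) (sym (+-identityʳ a))
range-++ a (suc k) l =
  cong (a ∷_) (trans (range-++ (suc a) k l) (cong (λ b → range (suc a) k ++ range b l) (sym (+-suc a k))))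

range-snoc : ∀ a k → range a (suc k) ≡ range a k ++ [ a + k ]
range-snoc a k = trans (cong (range a) (+-comm 1 k)) (range-++ a k 1)

range-bounds : ∀ a k → All (λ x → a ≤ x × x < a + k) (range a k)
range-bounds a zero    = []
range-bounds a (suc k) =
  (≤-refl , m<m+n a (s≤s z≤n)) ∷
  All.map (λ { {x} (l , u) → ≤-trans (n≤1+n a) l , subst (x <_) (sym (+-suc a k)) u }) (range-bounds (suc a) k)

-- Multiplicities and two-fold coverings

[_≈_] : ℕ → ℕ → ℕ
[ a ≈ b ] = if a ≡ᵇ b then 1 else 0

≈-true : ∀ {a b} → a ≡ b → [ a ≈ b ] ≡ 1
≈-true e = cong (λ b → if b then 1 else 0) (≡ᵇ-true e)

≈-false : ∀ {a b} → ¬ a ≡ b → [ a ≈ b ] ≡ 0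
≈-false e = cong (λ b → if b then 1 else 0) (≡ᵇ-false e)

tally : ℕ → List ℕ → ℕ
tally y xs = sum (map [_≈ y ] xs)

tally-∉ : ∀ y xs → All (λ x → ¬ x ≡ y) xs → tally y xs ≡ 0
tally-∉ y []       []       = refl
tally-∉ y (x ∷ xs) (p ∷ ps) = cong₂ _+_ (≈-false p) (tally-∉ y xs ps)

tally-range-above : ∀ y a k → a + k ≤ y → tally y (range a k) ≡ 0
tally-range-above y a k le = tally-∉ y _ (All.map (λ (_ , u) → <⇒≢ (<-≤-trans u le)) (range-bounds a k))

tally-range-below : ∀ y a k → y < a → tally y (range a k) ≡ 0
tally-range-below y a k lt = tally-∉ y _ (All.map (λ (l , _) → >⇒≢ (<-≤-trans lt l)) (range-bounds a k))

tally-range-within : ∀ y a k → a ≤ y → y < a + k → tally y (range a k) ≡ 1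
tally-range-within y a zero    l u = ⊥-elim (<⇒≱ u (subst (_≤ y) (sym (+-identityʳ a)) l))
tally-range-within y a (suc k) l u with a ≟ y
... | yes refl = cong₂ _+_ (≈-true {a} refl) (tally-range-below a (suc a) k ≤-refl)
... | no  a≢y  = cong₂ _+_ (≈-false a≢y)
  (tally-range-within y (suc a) k (≤∧≢⇒< l a≢y) (subst (y <_) (+-suc a k) u))

tally-++ : ∀ y xs ys → tally y (xs ++ ys) ≡ tally y xs + tally y ys
tally-++ y xs ys = trans (cong sum (map-++ _ xs ys)) (sum-++ (map _ xs) _)

sum-hits : ∀ {v} y y′ → y + y′ ≡ v → ∀ xs → sum (map (hits v y) xs) ≡ tally y xs + tally y′ xs
sum-hits {v} y y′ e []       = refl
sum-hits {v} y y′ e (x ∷ xs) =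
  trans (cong₂ _+_ (cong ([ x ≈ y ] +_) (cong (λ b → if b then 1 else 0) flip)) (sum-hits y y′ e xs))
        (interchange [ x ≈ y ] [ x ≈ y′ ] (tally y xs) _)
  where
  flip : (x + y ≡ᵇ v) ≡ (x ≡ᵇ y′)
  flip = ≡ᵇ-cong (x + y) v x y′
    (λ h → +-cancelˡ-≡ y x y′ (trans (+-comm y x) (trans h (sym e))))
    (λ { refl → trans (+-comm x y) e })

inRange-range : ∀ {v N} → N < v → All (InRange v) (range 1 N)
inRange-range N<v = All.map (λ (l , u) → l , <-≤-trans u N<v) (range-bounds 1 _)

-- Of two complementary residues of the odd modulus `2N + 1`, exactly one is at most `N`.
twoFold-odd : ∀ N → TwoFold (suc (N + N)) (range 1 N ++ range 1 N)
twoFold-odd N = Allₚ.++⁺ bounds bounds , covers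
  where
  R = range 1 N
  bounds = inRange-range (s≤s (m≤m+n N N))
  once : ∀ y y′ → 0 < y → 0 < y′ → y + y′ ≡ suc (N + N) → tally y R + tally y′ R ≡ 1
  once y y′ 0<y 0<y′ e with y ≤? N
  ... | yes y≤N = cong₂ _+_ (tally-range-within y 1 N 0<y (s≤s y≤N))
          (tally-range-above y′ 1 N (≮⇒≥ λ y′<1+N →
            <⇒≢ (s≤s (+-mono-≤ y≤N (s≤s⁻¹ y′<1+N))) e))
  ... | no  y≰N = cong₂ _+_ (tally-range-above y 1 N (≰⇒> y≰N))
          (tally-range-within y′ 1 N 0<y′ (≰⇒> λ N<y′ →
            <⇒≢ (subst (λ x → suc x ≤ y + y′) (+-suc N N) (+-mono-≤ (≰⇒> y≰N) N<y′)) (sym e)))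
  covers : ∀ y y′ → 0 < y → 0 < y′ → y + y′ ≡ suc (N + N) → sum (map (hits (suc (N + N)) y) (R ++ R)) ≡ 2
  covers y y′ 0<y 0<y′ e = begin
    _                                                  ≡⟨ sum-hits y y′ e (R ++ R) ⟩
    tally y (R ++ R) + tally y′ (R ++ R)               ≡⟨ cong₂ _+_ (tally-++ y R R) (tally-++ y′ R R) ⟩
    (tally y R + tally y R) + (tally y′ R + tally y′ R) ≡⟨ interchange (tally y R) _ _ _ ⟩
    (tally y R + tally y′ R) + (tally y R + tally y′ R) ≡⟨ cong₂ _+_ (once y y′ 0<y 0<y′ e) (once y y′ 0<y 0<y′ e) ⟩
    2                                                  ∎
    where open ≡-Reasoning

-- Here `h` is its own complement, so a single occurrence is hit by both tests and already counts
-- twice. Of any other complementary pair, exactly one member lies in the range `1 … N`, which is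
-- listed twice.
twoFold-even : ∀ N → TwoFold (suc N + suc N) (range 1 N ++ range 1 N ++ [ suc N ])
twoFold-even N = Allₚ.++⁺ bounds (Allₚ.++⁺ bounds ((s≤s z≤n , m<m+n (suc N) (s≤s z≤n)) ∷ [])) , covers
  where
  R = range 1 N
  h = suc N
  bounds = inRange-range (m≤m+n (suc N) (suc N))
  regroup : ∀ a b c d → (a + (a + c)) + (b + (b + d)) ≡ (a + b) + (a + b) + (c + d)
  regroup = solve-∀
  once : ∀ y y′ → 0 < y → 0 < y′ → y + y′ ≡ h + h →
    (tally y R + tally y′ R) + (tally y R + tally y′ R) + (tally y [ h ] + tally y′ [ h ]) ≡ 2
  once y y′ 0<y 0<y′ e = cases (<-cmp y h)
    where
    total : ∀ {a b c d} → tally y R ≡ a → tally y′ R ≡ b → [ h ≈ y ] ≡ c → [ h ≈ y′ ] ≡ d →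
      (tally y R + tally y′ R) + (tally y R + tally y′ R) + (tally y [ h ] + tally y′ [ h ])
      ≡ (a + b) + (a + b) + ((c + 0) + (d + 0))
    total refl refl refl refl = refl
    cases : Tri (y < h) (y ≡ h) (h < y) → _
    cases (tri≈ _ y≡h _) =
      total (tally-range-above y 1 N (≤-reflexive (sym y≡h))) (tally-range-above y′ 1 N (≤-reflexive (sym y′≡h)))
            (≈-true (sym y≡h)) (≈-true (sym y′≡h))
      where y′≡h = +-cancelˡ-≡ h y′ h (trans (cong (_+ y′) (sym y≡h)) e)
    cases (tri< y<h _ _) =
      total (tally-range-within y 1 N 0<y y<h) (tally-range-above y′ 1 N (<⇒≤ h<y′))
            (≈-false (>⇒≢ y<h)) (≈-false (<⇒≢ h<y′))
      where h<y′ = ≰⇒> λ y′≤h → <⇒≢ (+-mono-<-≤ y<h y′≤h) e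
    cases (tri> _ _ h<y) =
      total (tally-range-above y 1 N (<⇒≤ h<y)) (tally-range-within y′ 1 N 0<y′ y′<h)
            (≈-false (<⇒≢ h<y)) (≈-false (>⇒≢ y′<h))
      where y′<h = ≰⇒> λ h≤y′ → <⇒≢ (+-mono-<-≤ h<y h≤y′) (sym e)
  covers : ∀ y y′ → 0 < y → 0 < y′ → y + y′ ≡ h + h → sum (map (hits (h + h) y) (R ++ R ++ [ h ])) ≡ 2
  covers y y′ 0<y 0<y′ e = begin
    _  ≡⟨ sum-hits y y′ e (R ++ R ++ [ h ]) ⟩
    _  ≡⟨ cong₂ _+_ (split y) (split y′) ⟩
    (tally y R + (tally y R + tally y [ h ])) + (tally y′ R + (tally y′ R + tally y′ [ h ]))
       ≡⟨ regroup (tally y R) (tally y′ R) (tally y [ h ]) _ ⟩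
    _  ≡⟨ once y y′ 0<y 0<y′ e ⟩
    2  ∎
    where
    open ≡-Reasoning
    split : ∀ z → tally z (R ++ R ++ [ h ]) ≡ tally z R + (tally z R + tally z [ h ])
    split z = trans (tally-++ z R _) (cong (tally z R +_) (tally-++ z R _))

-- Two nests side by side, up to permutation

open MonoidSolver (↭ₚ.++-commutativeMonoid {A = ℕ}) using (solve; _⊜_; _⊕_) renaming (id to nil)

Triple : Set
Triple = ℕ × ℕ × ℕ

-- Langford-type nest: the pairs (lo, lo+s), (lo+1, lo+1+(s-2)), … around a central gap of length e.
nest : ℕ → ℕ → ℕ → List Triple
nest e lo zero    = []
nest e lo (suc k) = (suc (k * 2 + e) , lo , suc (lo + (k * 2 + e))) ∷ nest e (suc lo) k

members : Triple → List ℕ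
members (a , b , c) = a ∷ b ∷ c ∷ []

-- The differences are `e + 1`, `e + 3`, ... in one nest and `e + 2`, `e + 4`, ... in the other, so
-- together they fill an interval. With its gap filled, each nest of pairs is an interval as well.
-- The induction removes the outermost pair of both nests, which carry the two largest differences.
two-nests : ∀ e lo lo′ k →
  concatMap members (nest e lo k) ++ concatMap members (nest (suc e) lo′ k)
    ++ range (lo + k) e ++ range (lo′ + k) (suc e)
  ↭ range (suc e) (k * 2) ++ range lo (k * 2 + e) ++ range lo′ (k * 2 + suc e)
two-nests e lo lo′ zero rewrite +-identityʳ lo | +-identityʳ lo′ = ↭-refl
two-nests e lo lo′ (suc k) = begin
  s ∷ lo ∷ hi ∷ X ++ (s′ ∷ lo′ ∷ hi′ ∷ Y) ++ range (lo + suc k) e ++ range (lo′ + suc k) (suc e)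
    ≡⟨ cong₂ (λ a b → s ∷ lo ∷ hi ∷ X ++ (s′ ∷ lo′ ∷ hi′ ∷ Y) ++ range a e ++ range b (suc e)) (+-suc lo k) (+-suc lo′ k) ⟩
  s ∷ lo ∷ hi ∷ X ++ (s′ ∷ lo′ ∷ hi′ ∷ Y) ++ G ++ G′
    ↭⟨ solve 10 (λ s lo hi X s′ lo′ hi′ Y G G′ →
         s ⊕ lo ⊕ hi ⊕ X ⊕ (s′ ⊕ lo′ ⊕ hi′ ⊕ Y) ⊕ G ⊕ G′ ⊜ (s ⊕ lo ⊕ hi ⊕ s′ ⊕ lo′ ⊕ hi′) ⊕ (X ⊕ Y ⊕ G ⊕ G′)) ↭-refl
         [ s ] [ lo ] [ hi ] X [ s′ ] [ lo′ ] [ hi′ ] Y G G′ ⟩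
  (s ∷ lo ∷ hi ∷ s′ ∷ lo′ ∷ hi′ ∷ []) ++ (X ++ Y ++ G ++ G′)
    ↭⟨ ↭ₚ.++⁺ˡ (s ∷ lo ∷ hi ∷ s′ ∷ lo′ ∷ hi′ ∷ []) (two-nests e (suc lo) (suc lo′) k) ⟩
  (s ∷ lo ∷ hi ∷ s′ ∷ lo′ ∷ hi′ ∷ []) ++ (S ++ P ++ P′)
    ↭⟨ solve 9 (λ s lo hi s′ lo′ hi′ S P P′ →
         (s ⊕ lo ⊕ hi ⊕ s′ ⊕ lo′ ⊕ hi′) ⊕ (S ⊕ P ⊕ P′) ⊜ ((S ⊕ s) ⊕ s′) ⊕ (lo ⊕ P ⊕ hi) ⊕ (lo′ ⊕ P′ ⊕ hi′)) ↭-refl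
         [ s ] [ lo ] [ hi ] [ s′ ] [ lo′ ] [ hi′ ] S P P′ ⟩
  ((S ++ [ s ]) ++ [ s′ ]) ++ (lo ∷ P ++ [ hi ]) ++ (lo′ ∷ P′ ++ [ hi′ ])
    ≡⟨ cong₂ _++_ singles (cong₂ (λ A B → (lo ∷ A) ++ (lo′ ∷ B)) (sym (range-snoc (suc lo) (k * 2 + e))) (sym (range-snoc (suc lo′) (k * 2 + suc e)))) ⟩
  range (suc e) (suc k * 2) ++ range lo (suc k * 2 + e) ++ range lo′ (suc k * 2 + suc e) ∎
  where
  open PermutationReasoning
  s = suc (k * 2 + e)
  s′ = suc (k * 2 + suc e)
  hi = suc (lo + (k * 2 + e))
  hi′ = suc (lo′ + (k * 2 + suc e))
  X = concatMap members (nest e (suc lo) k)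
  Y = concatMap members (nest (suc e) (suc lo′) k)
  G = range (suc lo + k) e
  G′ = range (suc lo′ + k) (suc e)
  S = range (suc e) (k * 2)
  P = range (suc lo) (k * 2 + e)
  P′ = range (suc lo′) (k * 2 + suc e)
  singles : (S ++ [ s ]) ++ [ s′ ] ≡ range (suc e) (suc k * 2)
  singles = trans
    (cong₂ (λ a b → (S ++ [ a ]) ++ [ b ]) (cong suc (+-comm (k * 2) e))
           (cong suc (trans (+-comm (k * 2) (suc e)) (sym (+-suc e (k * 2))))))
    (sym (trans (range-snoc (suc e) (suc (k * 2)))
                (cong (_++ [ suc e + suc (k * 2) ]) (range-snoc (suc e) (k * 2)))))

-- Arrays built from rows in opposite pairs

posSum-++ : ∀ r s → posSum (r ++ s) ≡ posSum r + posSum s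
posSum-++ r s = trans (cong sum (map-++ posPart r s)) (sum-++ (map posPart r) _)

negSum-++ : ∀ r s → negSum (r ++ s) ≡ negSum r + negSum s
negSum-++ r s = trans (cong sum (map-++ negPart r s)) (sum-++ (map negPart r) _)

zeroSum-++ : ∀ r s → ZeroSum r → ZeroSum s → ZeroSum (r ++ s)
zeroSum-++ r s zr zs = trans (posSum-++ r s) (trans (cong₂ _+_ zr zs) (sym (negSum-++ r s)))

posSum-opposite : ∀ r → posSum (map opposite r) ≡ negSum r
posSum-opposite []          = refl
posSum-opposite (pos n ∷ r) = posSum-opposite r
posSum-opposite (neg n ∷ r) = cong (n +_) (posSum-opposite r)

negSum-opposite : ∀ r → negSum (map opposite r) ≡ posSum r
negSum-opposite []          = refl
negSum-opposite (pos n ∷ r) = cong (n +_) (negSum-opposite r)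
negSum-opposite (neg n ∷ r) = negSum-opposite r

balanced-opposite : ∀ {v} r → Balanced v r → Balanced v (map opposite r)
balanced-opposite {v} r (a , b , eq) = b , a ,
  trans (cong (_+ b * v) (posSum-opposite r)) (trans (sym eq) (cong (_+ a * v) (sym (negSum-opposite r))))

abs-opposite : ∀ r → map ∣_∣ (map opposite r) ≡ map ∣_∣ r
abs-opposite []          = refl
abs-opposite (pos n ∷ r) = cong (n ∷_) (abs-opposite r)
abs-opposite (neg n ∷ r) = cong (n ∷_) (abs-opposite r)

mirror : List Row → List Row
mirror []       = []
mirror (r ∷ rs) = r ∷ map opposite r ∷ mirror rs

length-mirror : ∀ rs → length (mirror rs) ≡ length rs * 2
length-mirror []       = refl
length-mirror (r ∷ rs) = cong (2 +_) (length-mirror rs)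

mirror-All : ∀ {P : Row → Set} → (∀ r → P r → P (map opposite r)) → ∀ {rs} → All P rs → All P (mirror rs)
mirror-All f []                = []
mirror-All f {r ∷ rs} (p ∷ ps) = p ∷ f r p ∷ mirror-All f ps

-- Entries of `r` and its opposite cancel in pairs; beyond the end of `r` both are read as the
-- default `pos 0`.
column-mirror : ∀ rs j → ZeroSum (column (mirror rs) j)
column-mirror []       j = refl
column-mirror (r ∷ rs) j = zeroSum-++ (entry r j ∷ entry (map opposite r) j ∷ []) (column (mirror rs) j)
                                      (cancel r j) (column-mirror rs j)
  where
  cancel : ∀ r j → ZeroSum (entry r j ∷ entry (map opposite r) j ∷ [])
  cancel []          j       = refl
  cancel (pos n ∷ r) zero    = refl
  cancel (neg n ∷ r) zero    = refl
  cancel (_ ∷ r)     (suc j) = cancel r j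

absolutes-∷ : ∀ r rs → absolutes (r ∷ rs) ≡ map ∣_∣ r ++ absolutes rs
absolutes-∷ r rs = map-++ ∣_∣ r (concat rs)

absolutes-++ : ∀ rs ss → absolutes (rs ++ ss) ≡ absolutes rs ++ absolutes ss
absolutes-++ []       ss = refl
absolutes-++ (r ∷ rs) ss = begin
  absolutes (r ∷ rs ++ ss)                      ≡⟨ absolutes-∷ r (rs ++ ss) ⟩
  map ∣_∣ r ++ absolutes (rs ++ ss)             ≡⟨ cong (map ∣_∣ r ++_) (absolutes-++ rs ss) ⟩
  map ∣_∣ r ++ (absolutes rs ++ absolutes ss)   ≡⟨ ++-assoc (map ∣_∣ r) _ _ ⟨
  (map ∣_∣ r ++ absolutes rs) ++ absolutes ss   ≡⟨ cong (_++ absolutes ss) (absolutes-∷ r rs) ⟨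
  absolutes (r ∷ rs) ++ absolutes ss            ∎
  where open ≡-Reasoning

absolutes-mirror : ∀ rs → absolutes (mirror rs) ↭ absolutes rs ++ absolutes rs
absolutes-mirror []       = ↭-refl
absolutes-mirror (r ∷ rs) = begin
  absolutes (r ∷ map opposite r ∷ mirror rs)
    ≡⟨ trans (absolutes-∷ r (map opposite r ∷ mirror rs)) (cong (map ∣_∣ r ++_) (absolutes-∷ (map opposite r) (mirror rs))) ⟩
  map ∣_∣ r ++ map ∣_∣ (map opposite r) ++ absolutes (mirror rs)
    ≡⟨ cong (λ a → map ∣_∣ r ++ a ++ absolutes (mirror rs)) (abs-opposite r) ⟩
  map ∣_∣ r ++ map ∣_∣ r ++ absolutes (mirror rs)
    ↭⟨ ↭ₚ.++⁺ˡ (map ∣_∣ r) (↭ₚ.++⁺ˡ (map ∣_∣ r) (absolutes-mirror rs)) ⟩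
  map ∣_∣ r ++ map ∣_∣ r ++ absolutes rs ++ absolutes rs
    ↭⟨ solve 2 (λ a b → a ⊕ a ⊕ b ⊕ b ⊜ (a ⊕ b) ⊕ (a ⊕ b)) ↭-refl (map ∣_∣ r) (absolutes rs) ⟩
  (map ∣_∣ r ++ absolutes rs) ++ (map ∣_∣ r ++ absolutes rs)
    ≡⟨ cong₂ _++_ (absolutes-∷ r rs) (absolutes-∷ r rs) ⟨
  absolutes (r ∷ rs) ++ absolutes (r ∷ rs) ∎
  where open PermutationReasoning

-- A partition of `xs` into `t` signed rows of width `n` with sum 0 modulo `v`. These are the upper
-- halves of the opposite pairs.
record Vectors (v n t : ℕ) (xs : List ℕ) : Set where
  field
    rows   : List Row
    count  : length rows ≡ t
    widths : All (λ r → length r ≡ n) rows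
    sums   : All (Balanced v) rows
    uses   : absolutes rows ↭ xs

noVectors : ∀ {v n} → Vectors v n 0 []
noVectors = record { rows = [] ; count = refl ; widths = [] ; sums = [] ; uses = ↭-refl }

addVector : ∀ {v n t xs ys} r → length r ≡ n → Balanced v r → map ∣_∣ r ↭ xs →
  Vectors v n t ys → Vectors v n (suc t) (xs ++ ys)
addVector r l b p V = record
  { rows   = r ∷ rows
  ; count  = cong suc count
  ; widths = l ∷ widths
  ; sums   = b ∷ sums
  ; uses   = ↭-trans (↭-reflexive (absolutes-∷ r rows)) (↭ₚ.++⁺ p uses)
  }
  where open Vectors V

reorder : ∀ {v n t xs ys} → xs ↭ ys → Vectors v n t xs → Vectors v n t ys
reorder p V = record { Vectors V hiding (uses) ; uses = ↭-trans (Vectors.uses V) p }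

-- The mirrored rows contribute zero to every column and each number of `xs` twice, so only the
-- columns of `top` have to cancel by themselves.
stack : ∀ {v m n t xs ys} (top : List Row) → v ≡ suc (m * n) → length top + t * 2 ≡ m →
  All (λ r → length r ≡ n) top → All (Balanced v) top → (∀ j → j < n → ZeroSum (column top j)) →
  Vectors v n t xs → absolutes top ++ xs ++ xs ↭ ys → TwoFold v ys → H2Exists m n
stack {xs = xs} {ys} top refl height widths sums colSums V perm two =
  realise (top ++ mirror rows)
    (trans (length-++ top) (trans (cong (length top +_) (trans (length-mirror rows) (cong (_* 2) count))) height))
    (Allₚ.++⁺ widths (mirror-All (λ r e → trans (length-map opposite r) e) V.widths))
    (Allₚ.++⁺ sums (mirror-All balanced-opposite V.sums))
    (λ j j<n → zeroSum⇒balanced {r = column (top ++ mirror rows) j}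
      (subst ZeroSum (sym (map-++ (λ r → entry r j) top (mirror rows)))
        (zeroSum-++ (column top j) _ (colSums j j<n) (column-mirror rows j))))
    (TwoFold-resp-↭ (↭-sym uses) two)
  where
  module V = Vectors V
  open V using (rows; count)
  uses : absolutes (top ++ mirror rows) ↭ ys
  uses = begin
    absolutes (top ++ mirror rows)                   ≡⟨ absolutes-++ top (mirror rows) ⟩
    absolutes top ++ absolutes (mirror rows)         ↭⟨ ↭ₚ.++⁺ˡ (absolutes top) (absolutes-mirror rows) ⟩
    absolutes top ++ absolutes rows ++ absolutes rows ↭⟨ ↭ₚ.++⁺ˡ (absolutes top) (↭ₚ.++⁺ V.uses V.uses) ⟩
    absolutes top ++ xs ++ xs                        ↭⟨ perm ⟩
    ys                                               ∎
    where open PermutationReasoning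

mirrored : ∀ {v n t N} → v ≡ suc (N + N) → t * n ≡ N → Vectors v n t (range 1 N) → H2Exists (t * 2) n
mirrored {n = n} {t} refl refl V =
  stack [] (cong suc (double t n)) refl [] [] (λ _ _ → refl) V ↭-refl (twoFold-odd (t * n))
  where
  double : ∀ t n → t * n + t * n ≡ t * 2 * n
  double = solve-∀

-- Three rows with columns in opposite pairs

Column : Set
Column = Signed × Signed × Signed

first second third : Column → Signed
first  = proj₁
second = proj₁ ∘ proj₂
third  = proj₂ ∘ proj₂

entries : Column → Row
entries (a , b , c) = a ∷ b ∷ c ∷ []

toRows : List Column → List Row
toRows cs = map first cs ∷ map second cs ∷ map third cs ∷ []

mirrorColumns : List Triple → List Column
mirrorColumns []                 = []
mirrorColumns ((a , b , c) ∷ ts) = (pos a , pos b , neg c) ∷ (neg a , neg b , pos c) ∷ mirrorColumns ts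

length-mirrorColumns : ∀ ts → length (mirrorColumns ts) ≡ length ts * 2
length-mirrorColumns []       = refl
length-mirrorColumns (_ ∷ ts) = cong (2 +_) (length-mirrorColumns ts)

-- Every triple puts a number and its negative into each of the three rows. The columns, in
-- contrast, cancel because of `a + b ≡ c`.
mirrorColumns-rows : ∀ ts → All ZeroSum (toRows (mirrorColumns ts))
mirrorColumns-rows []                 = refl ∷ refl ∷ refl ∷ []
mirrorColumns-rows ((a , b , c) ∷ ts) with mirrorColumns-rows ts
... | p ∷ q ∷ r ∷ [] = cong (a +_) p ∷ cong (b +_) q ∷ cong (c +_) r ∷ []

Additive : Triple → Set
Additive (a , b , c) = a + b ≡ c

mirrorColumns-columns : ∀ {ts} → All Additive ts → All (ZeroSum ∘ entries) (mirrorColumns ts)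
mirrorColumns-columns []                           = []
mirrorColumns-columns (_∷_ {x = a , b , _} refl es) =
  trans (cong (a +_) (+-identityʳ b)) (sym (+-identityʳ (a + b))) ∷
  trans (+-identityʳ (a + b)) (cong (a +_) (sym (+-identityʳ b))) ∷
  mirrorColumns-columns es

columnAbsolutes : List Column → List ℕ
columnAbsolutes = concatMap (map ∣_∣ ∘ entries)

columnAbsolutes-mirror : ∀ ts →
  columnAbsolutes (mirrorColumns ts) ↭ concatMap members ts ++ concatMap members ts
columnAbsolutes-mirror []                 = ↭-refl
columnAbsolutes-mirror ((a , b , c) ∷ ts) = begin
  ms ++ ms ++ columnAbsolutes (mirrorColumns ts)  ↭⟨ ↭ₚ.++⁺ˡ ms (↭ₚ.++⁺ˡ ms (columnAbsolutes-mirror ts)) ⟩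
  ms ++ ms ++ X ++ X   ↭⟨ solve 2 (λ m x → m ⊕ m ⊕ x ⊕ x ⊜ (m ⊕ x) ⊕ (m ⊕ x)) ↭-refl ms X ⟩
  (ms ++ X) ++ (ms ++ X)  ∎
  where
  open PermutationReasoning
  ms = a ∷ b ∷ c ∷ []
  X = concatMap members ts

absolutes-toRows : ∀ cs → absolutes (toRows cs) ↭ columnAbsolutes cs
absolutes-toRows cs = ↭-trans (↭-reflexive split) (gather cs)
  where
  A = map (∣_∣ ∘ first)
  B = map (∣_∣ ∘ second)
  C = map (∣_∣ ∘ third)
  split : absolutes (toRows cs) ≡ A cs ++ B cs ++ C cs ++ []
  split = trans (absolutes-∷ (map first cs) (map second cs ∷ map third cs ∷ [])) (cong₂ _++_ (sym (map-∘ cs))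
    (trans (absolutes-∷ (map second cs) (map third cs ∷ [])) (cong₂ _++_ (sym (map-∘ cs))
      (trans (absolutes-∷ (map third cs) []) (cong (_++ []) (sym (map-∘ cs)))))))
  gather : ∀ cs → A cs ++ B cs ++ C cs ++ [] ↭ columnAbsolutes cs
  gather []                 = ↭-refl
  gather ((a , b , c) ∷ cs) = ↭-trans
    (solve 6 (λ a b c X Y Z → (a ⊕ X) ⊕ (b ⊕ Y) ⊕ (c ⊕ Z) ⊜ (a ⊕ b ⊕ c) ⊕ (X ⊕ Y ⊕ Z)) ↭-refl
      [ ∣ a ∣ ] [ ∣ b ∣ ] [ ∣ c ∣ ] (A cs) (B cs) (C cs ++ []))
    (↭ₚ.++⁺ˡ (∣ a ∣ ∷ ∣ b ∣ ∷ ∣ c ∣ ∷ []) (gather cs))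

column-toRows : ∀ {cs} → All (ZeroSum ∘ entries) cs → ∀ j → ZeroSum (column (toRows cs) j)
column-toRows []       j       = refl
column-toRows (p ∷ ps) zero    = p
column-toRows (p ∷ ps) (suc j) = column-toRows ps j

toRows-++ : ∀ cs ds → All ZeroSum (toRows cs) → All ZeroSum (toRows ds) → All ZeroSum (toRows (cs ++ ds))
toRows-++ cs ds (p ∷ q ∷ r ∷ []) (p′ ∷ q′ ∷ r′ ∷ []) = add first p p′ ∷ add second q q′ ∷ add third r r′ ∷ []
  where
  add : ∀ f → ZeroSum (map f cs) → ZeroSum (map f ds) → ZeroSum (map f (cs ++ ds))
  add f p q = subst ZeroSum (sym (map-++ f cs ds)) (zeroSum-++ (map f cs) _ p q)

-- The core uses `base` twice and `extra` once. Mirroring uses the triples twice (columns) and `xs`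
-- twice (rows), so a single copy of `base`, triples and `xs` has to partition `1 … N`. For odd
-- `mn`, `extra` holds the number `v / 2`.
threeRows : ∀ {v n t xs} (core : List Column) (ts : List Triple) (base extra : List ℕ) (N : ℕ) →
  v ≡ suc ((3 + t * 2) * n) → length core + length ts * 2 ≡ n →
  All (ZeroSum ∘ entries) core → All ZeroSum (toRows core) → All Additive ts →
  Vectors v n t xs →
  columnAbsolutes core ↭ base ++ base ++ extra →
  base ++ concatMap members ts ++ xs ↭ range 1 N →
  TwoFold v (range 1 N ++ range 1 N ++ extra) →
  H2Exists (3 + t * 2) n
threeRows {n = n} {xs = xs} core ts base extra N v≡ width cols rows adds V coreUses allUses two =
  stack (toRows cs) v≡ refl
    (width′ first ∷ width′ second ∷ width′ third ∷ [])
    (All.map (λ {r} → zeroSum⇒balanced {r = r}) (toRows-++ core (mirrorColumns ts) rows (mirrorColumns-rows ts)))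
    (λ j _ → column-toRows (Allₚ.++⁺ cols (mirrorColumns-columns adds)) j)
    V uses two
  where
  cs = core ++ mirrorColumns ts
  T = concatMap members ts
  width′ : ∀ f → length (map f cs) ≡ n
  width′ f = trans (length-map f cs) (trans (length-++ core)
    (trans (cong (length core +_) (length-mirrorColumns ts)) width))
  uses : absolutes (toRows cs) ++ xs ++ xs ↭ range 1 N ++ range 1 N ++ extra
  uses = begin
    absolutes (toRows cs) ++ xs ++ xs
      ↭⟨ ↭ₚ.++⁺ʳ (xs ++ xs) (absolutes-toRows cs) ⟩
    columnAbsolutes cs ++ xs ++ xs
      ≡⟨ cong (_++ xs ++ xs) (concatMap-++ (map ∣_∣ ∘ entries) core (mirrorColumns ts)) ⟩
    (columnAbsolutes core ++ columnAbsolutes (mirrorColumns ts)) ++ xs ++ xs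
      ↭⟨ ↭ₚ.++⁺ʳ (xs ++ xs) (↭ₚ.++⁺ coreUses (columnAbsolutes-mirror ts)) ⟩
    ((base ++ base ++ extra) ++ (T ++ T)) ++ xs ++ xs
      ↭⟨ solve 4 (λ b e t x → ((b ⊕ b ⊕ e) ⊕ (t ⊕ t)) ⊕ x ⊕ x ⊜ (b ⊕ t ⊕ x) ⊕ (b ⊕ t ⊕ x) ⊕ e) ↭-refl base extra T xs ⟩
    (base ++ T ++ xs) ++ (base ++ T ++ xs) ++ extra
      ↭⟨ ↭ₚ.++⁺ allUses (↭ₚ.++⁺ʳ extra allUses) ⟩
    range 1 N ++ range 1 N ++ extra ∎
    where open PermutationReasoning

-- Padding by consecutive quadruples

-- Since `z - (z + 1) - (z + 2) + (z + 3) = 0`, any row can be lengthened by a multiple of 4 with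
-- consecutive numbers and no effect on its sum.
quads : ℕ → ℕ → Row
quads z zero    = []
quads z (suc q) = pos z ∷ neg (1 + z) ∷ neg (2 + z) ∷ pos (3 + z) ∷ quads (4 + z) q

length-quads : ∀ z q → length (quads z q) ≡ q * 4
length-quads z zero    = refl
length-quads z (suc q) = cong (4 +_) (length-quads (4 + z) q)

quads-uses : ∀ z q → map ∣_∣ (quads z q) ≡ range z (q * 4)
quads-uses z zero    = refl
quads-uses z (suc q) = cong (λ xs → z ∷ 1 + z ∷ 2 + z ∷ 3 + z ∷ xs) (quads-uses (4 + z) q)

quads-zeroSum : ∀ z q → ZeroSum (quads z q)
quads-zeroSum z zero    = refl
quads-zeroSum z (suc q) =
  zeroSum-++ (pos z ∷ neg (1 + z) ∷ neg (2 + z) ∷ pos (3 + z) ∷ []) (quads (4 + z) q)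
    (one z) (quads-zeroSum (4 + z) q)
  where
  one : ∀ z → z + ((3 + z) + 0) ≡ (1 + z) + ((2 + z) + 0)
  one = solve-∀

-- Even width

record Padded (v n : ℕ) (r : Row) (z q : ℕ) : Set where
  field
    width : length (r ++ quads z q) ≡ n
    sum0  : Balanced v (r ++ quads z q)
    uses  : map ∣_∣ (r ++ quads z q) ≡ map ∣_∣ r ++ range z (q * 4)

pad : ∀ {v} r z q → Balanced v r → Padded v (length r + q * 4) r z q
pad {v} r z q (a , b , eq) = record
  { width = trans (length-++ r) (cong (length r +_) (length-quads z q))
  ; sum0  = a , b , (begin
      posSum (r ++ quads z q) + a * v           ≡⟨ cong (_+ a * v) (posSum-++ r (quads z q)) ⟩
      posSum r + posSum (quads z q) + a * v     ≡⟨ swapʳ (posSum r) _ (a * v) ⟩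
      posSum r + a * v + posSum (quads z q)     ≡⟨ cong₂ _+_ eq (quads-zeroSum z q) ⟩
      negSum r + b * v + negSum (quads z q)     ≡⟨ swapʳ (negSum r) (b * v) _ ⟩
      negSum r + negSum (quads z q) + b * v     ≡⟨ cong (_+ b * v) (negSum-++ r (quads z q)) ⟨
      negSum (r ++ quads z q) + b * v           ∎)
  ; uses  = trans (map-++ ∣_∣ r (quads z q)) (cong (map ∣_∣ r ++_) (quads-uses z q))
  }
  where
  open ≡-Reasoning
  swapʳ : ∀ a b c → a + b + c ≡ a + c + b
  swapʳ = solve-∀

addPadded : ∀ {v t ys} r z q → Balanced v r → Vectors v (length r + q * 4) t ys →
  Vectors v (length r + q * 4) (suc t) ((map ∣_∣ r ++ range z (q * 4)) ++ ys)
addPadded r z q b V = addVector (r ++ quads z q) width sum0 (↭-reflexive uses) V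
  where open Padded (pad r z q b)

quadVectors : ∀ {v} q t a → Vectors v (q * 4) t (range a (t * (q * 4)))
quadVectors q zero    a = noVectors
quadVectors q (suc t) a =
  reorder (↭-reflexive (sym (range-++ a (q * 4) (t * (q * 4)))))
          (addPadded [] a q (0 , 0 , refl) (quadVectors q t (a + q * 4)))

-- A row of `6 + q * 4` consecutive numbers has an odd number of odd entries, so its integer sum is
-- never zero. Two rows together can exchange numbers and both reach zero. If `t` is odd, one row is
-- left over; it must reach an odd multiple of `v`, for which the hypothesis puts `N` at the end of
-- the range.
sixVectors : ∀ {v N} q t a → a + t * (6 + q * 4) ≡ suc N → v ≡ suc (N + N) →
  Vectors v (6 + q * 4) t (range a (t * (6 + q * 4)))
sixVectors q 0 a _ _ = noVectors
-- The sum of these six entries is 2 + (N − 1) + N = v.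
sixVectors {v} {N} q 1 a eq refl =
  reorder uses (addPadded r (4 + a) q (0 , 1 , sums) noVectors)
  where
  y = a + (4 + q * 4)
  N≡ : N ≡ suc y
  N≡ = suc-injective (trans (sym eq) (lem a q))
    where
    lem : ∀ a q → a + (6 + q * 4 + 0) ≡ suc (suc (a + (4 + q * 4)))
    lem = solve-∀
  r : Row
  r = neg a ∷ pos (1 + a) ∷ neg (2 + a) ∷ pos (3 + a) ∷ pos y ∷ pos (suc y) ∷ []
  sums : posSum r + 0 * v ≡ negSum r + 1 * suc (N + N)
  sums = subst (λ N → posSum r + 0 * v ≡ negSum r + 1 * suc (N + N)) (sym N≡) (lem a y)
    where
    lem : ∀ a y → (1 + a) + ((3 + a) + (y + (suc y + 0))) + 0 ≡ a + ((2 + a) + 0) + 1 * suc (suc y + suc y)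
    lem = solve-∀
  uses : (map ∣_∣ r ++ range (4 + a) (q * 4)) ++ [] ↭ range a (1 * (6 + q * 4))
  uses = begin
    (as ++ y ∷ suc y ∷ Q) ++ []
      ↭⟨ solve 3 (λ as ys Q → (as ⊕ ys ⊕ Q) ⊕ nil ⊜ as ⊕ Q ⊕ ys) ↭-refl as (y ∷ suc y ∷ []) Q ⟩
    as ++ Q ++ y ∷ suc y ∷ []
      ≡⟨ cong (λ b → as ++ Q ++ b ∷ suc b ∷ []) (lem a (q * 4)) ⟩
    as ++ Q ++ range (4 + a + q * 4) 2
      ≡⟨ cong (as ++_) (range-++ (4 + a) (q * 4) 2) ⟨
    range a (4 + (q * 4 + 2))
      ≡⟨ cong (range a) (len (q * 4)) ⟩
    range a (1 * (6 + q * 4)) ∎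
    where
    open PermutationReasoning
    as = range a 4
    Q = range (4 + a) (q * 4)
    lem : ∀ a x → a + (4 + x) ≡ 4 + a + x
    lem = solve-∀
    len : ∀ x → 4 + (x + 2) ≡ 6 + x + 0
    len = solve-∀
sixVectors {v} {N} q (suc (suc t)) a eq v≡ =
  reorder uses (addPadded A (12 + a) q (0 , 0 , sumA a) (addPadded B (12 + a + q * 4) q (0 , 0 , sumB a)
    (sixVectors q t (12 + a + q * 4 + q * 4) (trans (lem a q (t * (6 + q * 4))) eq) v≡)))
  where
  A B : Row
  -- In each row a pair of difference 2 cancels two consecutive pairs contributing -1 each. The
  -- pairs of difference 2 interleave to `a … a + 3`.
  A = neg a ∷ pos (2 + a) ∷ pos (4 + a) ∷ neg (5 + a) ∷ pos (6 + a) ∷ neg (7 + a) ∷ []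
  B = neg (1 + a) ∷ pos (3 + a) ∷ pos (8 + a) ∷ neg (9 + a) ∷ pos (10 + a) ∷ neg (11 + a) ∷ []
  sumA : ∀ a → (2 + a) + ((4 + a) + ((6 + a) + 0)) + 0 ≡ a + ((5 + a) + ((7 + a) + 0)) + 0
  sumA = solve-∀
  sumB : ∀ a → (3 + a) + ((8 + a) + ((10 + a) + 0)) + 0 ≡ (1 + a) + ((9 + a) + ((11 + a) + 0)) + 0
  sumB = solve-∀
  lem : ∀ a q s → (12 + a + q * 4 + q * 4) + s ≡ a + ((6 + q * 4) + ((6 + q * 4) + s))
  lem = solve-∀
  uses : (map ∣_∣ A ++ range (12 + a) (q * 4)) ++ (map ∣_∣ B ++ range (12 + a + q * 4) (q * 4))
           ++ range (12 + a + q * 4 + q * 4) (t * (6 + q * 4))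
         ↭ range a ((2 + t) * (6 + q * 4))
  uses = begin
    (map ∣_∣ A ++ X) ++ (map ∣_∣ B ++ Y) ++ Z
      ↭⟨ solve 9 (λ a₀ a₁ a₂ a₃ a₄ a₈ X Y Z →
           ((a₀ ⊕ a₂ ⊕ a₄) ⊕ X) ⊕ ((a₁ ⊕ a₃ ⊕ a₈) ⊕ Y) ⊕ Z ⊜ a₀ ⊕ a₁ ⊕ a₂ ⊕ a₃ ⊕ a₄ ⊕ a₈ ⊕ X ⊕ Y ⊕ Z) ↭-refl
           [ a ] [ 1 + a ] [ 2 + a ] [ 3 + a ] (range (4 + a) 4) (range (8 + a) 4) X Y Z ⟩
    range a 12 ++ X ++ Y ++ Z
      ≡⟨ cong (λ R → range a 12 ++ X ++ R) (range-++ (12 + a + q * 4) (q * 4) (t * (6 + q * 4))) ⟨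
    range a 12 ++ X ++ range (12 + a + q * 4) (q * 4 + t * (6 + q * 4))
      ≡⟨ cong (range a 12 ++_) (range-++ (12 + a) (q * 4) (q * 4 + t * (6 + q * 4))) ⟨
    range a (12 + (q * 4 + (q * 4 + t * (6 + q * 4))))
      ≡⟨ cong (range a) (len (q * 4) (t * (6 + q * 4))) ⟩
    range a ((2 + t) * (6 + q * 4)) ∎
    where
    open PermutationReasoning
    X = range (12 + a) (q * 4)
    Y = range (12 + a + q * 4) (q * 4)
    Z = range (12 + a + q * 4 + q * 4) (t * (6 + q * 4))
    len : ∀ x s → 12 + (x + (x + s)) ≡ (6 + x) + ((6 + x) + s)
    len = solve-∀

-- Two rows of odd length

twoByOdd₃ : ∀ q → H2Exists 2 (3 + q * 4)
twoByOdd₃ q = mirrored {t = 1} (refl {x = suc (N + N)}) refl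
  (reorder (↭-reflexive uses) (addPadded (pos 1 ∷ pos 2 ∷ neg 3 ∷ []) 4 q (0 , 0 , refl) noVectors))
  where
  N = 3 + q * 4 + 0
  uses : (1 ∷ 2 ∷ 3 ∷ range 4 (q * 4)) ++ [] ≡ range 1 N
  uses = trans (++-identityʳ _) (cong (range 1) (sym (+-identityʳ (3 + q * 4))))

-- Here the signed sum is v = 2(5 + 4q) + 1.
twoByOdd₅ : ∀ q → H2Exists 2 (5 + q * 4)
twoByOdd₅ q = mirrored {t = 1} (refl {x = suc (N + N)}) refl
  (reorder uses (addPadded r 4 q (0 , 1 , sums (q * 4)) noVectors))
  where
  N = 5 + q * 4 + 0
  y = 4 + q * 4
  Q = range 4 (q * 4)
  r : Row
  r = pos 1 ∷ neg 2 ∷ pos 3 ∷ pos y ∷ pos (suc y) ∷ []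
  sums : ∀ x → 1 + (3 + ((4 + x) + ((5 + x) + 0))) + 0 ≡ 2 + 1 * suc ((5 + x + 0) + (5 + x + 0))
  sums = solve-∀
  uses : (1 ∷ 2 ∷ 3 ∷ y ∷ suc y ∷ Q) ++ [] ↭ range 1 N
  uses = begin
    (range 1 3 ++ range y 2 ++ Q) ++ []
      ↭⟨ solve 3 (λ as ys Q → (as ⊕ ys ⊕ Q) ⊕ nil ⊜ as ⊕ Q ⊕ ys) ↭-refl (range 1 3) (range y 2) Q ⟩
    range 1 3 ++ Q ++ range y 2
      ≡⟨ cong (range 1 3 ++_) (range-++ 4 (q * 4) 2) ⟨
    range 1 (3 + (q * 4 + 2))
      ≡⟨ cong (range 1) (len (q * 4)) ⟩
    range 1 N ∎
    where
    open PermutationReasoning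
    len : ∀ x → 3 + (x + 2) ≡ 5 + x + 0
    len = solve-∀

-- Even numbers above 2 by residue modulo 4. The width 4 is separate because the general core for
-- multiples of 4 has eight columns.
data EvenWidth : ℕ → Set where
  four  : EvenWidth 4
  six+  : ∀ k → EvenWidth (6 + k * 4)
  eight+ : ∀ k → EvenWidth (8 + k * 4)

evenVectors : ∀ {v n N} → EvenWidth n → ∀ t a → a + t * n ≡ suc N → v ≡ suc (N + N) →
  Vectors v n t (range a (t * n))
evenVectors four       t a _  _ = quadVectors 1 t a
evenVectors (six+ k)   t a eq e = sixVectors k t a eq e
evenVectors (eight+ k) t a _  _ = quadVectors (2 + k) t a

evenByEven : ∀ {n} t → EvenWidth n → H2Exists (t * 2) n
evenByEven t w = mirrored refl refl (evenVectors w t 1 refl refl)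

-- An odd number of rows of even length

nest-additive : ∀ e lo k → All Additive (nest e lo k)
nest-additive e lo zero    = []
nest-additive e lo (suc k) = cong suc (+-comm (k * 2 + e) lo) ∷ nest-additive e (suc lo) k

length-nest : ∀ e lo k → length (nest e lo k) ≡ k
length-nest e lo zero    = refl
length-nest e lo (suc k) = cong suc (length-nest e (suc lo) k)

-- The three rows use `1 … N₀` twice, where `N₀` is `3n / 2`, and the paired rows take the next
-- `t * n` numbers. As `mn` is even, no number occurs just once.
threeRowsEven : ∀ {n} t → EvenWidth n → (core : List Column) (ts : List Triple) (base : List ℕ) (N₀ : ℕ) →
  N₀ + N₀ ≡ 3 * n → length core + length ts * 2 ≡ n →
  All (ZeroSum ∘ entries) core → All ZeroSum (toRows core) → All Additive ts →
  columnAbsolutes core ↭ base ++ base →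
  base ++ concatMap members ts ↭ range 1 N₀ →
  H2Exists (3 + t * 2) n
threeRowsEven {n} t w core ts base N₀ size width cols rows adds coreUses allUses =
  threeRows core ts base [] N (cong suc v≡) width cols rows adds (evenVectors w t (suc N₀) refl refl)
    (↭-trans coreUses (↭-reflexive (cong (base ++_) (sym (++-identityʳ base)))))
    uses
    (subst (λ xs → TwoFold (suc (N + N)) (range 1 N ++ xs)) (sym (++-identityʳ (range 1 N))) (twoFold-odd N))
  where
  N = N₀ + t * n
  v≡ : N + N ≡ (3 + t * 2) * n
  v≡ = trans (lem N₀ (t * n)) (trans (cong (_+ (t * n + t * n)) size) (lem′ t n))
    where
    lem : ∀ a b → (a + b) + (a + b) ≡ (a + a) + (b + b)
    lem = solve-∀
    lem′ : ∀ t n → 3 * n + (t * n + t * n) ≡ (3 + t * 2) * n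
    lem′ = solve-∀
  uses : base ++ concatMap members ts ++ range (suc N₀) (t * n) ↭ range 1 N
  uses = ↭-trans (↭-reflexive (sym (++-assoc base _ _)))
    (↭-trans (↭ₚ.++⁺ʳ (range (suc N₀) (t * n)) allUses) (↭-reflexive (sym (range-++ 1 N₀ (t * n)))))

-- The cores of the next three arrays were found by computer search.
threeByFour : ∀ t → H2Exists (3 + t * 2) 4
threeByFour t =
  threeRowsEven t four core [] (range 1 6) 6 refl refl
    (refl ∷ refl ∷ refl ∷ refl ∷ []) (refl ∷ refl ∷ refl ∷ []) [] coreUses ↭-refl
  where
  core : List Column
  core = (neg 1 , neg 5 , pos 6) ∷ (pos 6 , neg 4 , neg 2) ∷ (neg 2 , pos 5 , neg 3) ∷ (neg 3 , pos 4 , neg 1) ∷ []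
  coreUses : columnAbsolutes core ↭ range 1 6 ++ range 1 6
  coreUses = solve 6 (λ a b c d e f →
    a ⊕ e ⊕ f ⊕ f ⊕ d ⊕ b ⊕ b ⊕ e ⊕ c ⊕ c ⊕ d ⊕ a ⊜ (a ⊕ b ⊕ c ⊕ d ⊕ e ⊕ f) ⊕ (a ⊕ b ⊕ c ⊕ d ⊕ e ⊕ f))
    ↭-refl [ 1 ] [ 2 ] [ 3 ] [ 4 ] [ 5 ] [ 6 ]

blocks : ℕ → List ℕ → List ℕ
blocks a []       = []
blocks a (k ∷ ks) = range a k ++ blocks (a + k) ks

blocks≡range : ∀ a ks → blocks a ks ≡ range a (sum ks)
blocks≡range a []       = refl
blocks≡range a (k ∷ ks) = trans (cong (range a k ++_) (blocks≡range (a + k) ks)) (sym (range-++ a k (sum ks)))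

-- Consecutive intervals hold the number 1, the `2k` differences of the nests, four numbers from
-- `x`, the nest from `lo` with gap `g`, `b` numbers from `y`, the nest from `lo′` with gap
-- `z , z + 1`, and `t` numbers from `u`. Whatever is neither a difference nor in a pair is `spare`
-- and goes to the core.
module Layout (k b t : ℕ) where
  lengths : List ℕ
  lengths = 1 ∷ k * 2 ∷ 4 ∷ k * 2 + 1 ∷ b ∷ k * 2 + 2 ∷ t ∷ []

  x lo g y lo′ z u : ℕ
  x   = 2 + k * 2
  lo  = x + 4
  g   = lo + k
  y   = lo + (k * 2 + 1)
  lo′ = y + b
  z   = lo′ + k
  u   = lo′ + (k * 2 + 2)

  triples : List Triple
  triples = nest 1 lo k ++ nest 2 lo′ k

  additive : All Additive triples
  additive = Allₚ.++⁺ (nest-additive 1 lo k) (nest-additive 2 lo′ k)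

  count : length triples ≡ k + k
  count = trans (length-++ (nest 1 lo k)) (cong₂ _+_ (length-nest 1 lo k) (length-nest 2 lo′ k))

  spare : List ℕ
  spare = 1 ∷ range x 4 ++ g ∷ range y b ++ range z 2 ++ range u t

  uses : spare ++ concatMap members triples ↭ range 1 (sum lengths)
  uses = begin
    spare ++ concatMap members triples
      ≡⟨ cong (spare ++_) (concatMap-++ members (nest 1 lo k) (nest 2 lo′ k)) ⟩
    ([ 1 ] ++ range x 4 ++ [ g ] ++ range y b ++ range z 2 ++ range u t) ++ X ++ Y
      ↭⟨ solve 8 (λ o x g y z u X Y → (o ⊕ x ⊕ g ⊕ y ⊕ z ⊕ u) ⊕ X ⊕ Y ⊜ (o ⊕ x ⊕ y ⊕ u) ⊕ (X ⊕ Y ⊕ g ⊕ z)) ↭-refl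
           [ 1 ] (range x 4) [ g ] (range y b) (range z 2) (range u t) X Y ⟩
    ([ 1 ] ++ range x 4 ++ range y b ++ range u t) ++ (X ++ Y ++ range g 1 ++ range z 2)
      ↭⟨ ↭ₚ.++⁺ˡ ([ 1 ] ++ range x 4 ++ range y b ++ range u t) (two-nests 1 lo lo′ k) ⟩
    ([ 1 ] ++ range x 4 ++ range y b ++ range u t) ++ (S ++ P ++ P′)
      ↭⟨ solve 7 (λ o x y u S P P′ → (o ⊕ x ⊕ y ⊕ u) ⊕ (S ⊕ P ⊕ P′) ⊜ o ⊕ S ⊕ x ⊕ P ⊕ y ⊕ P′ ⊕ u ⊕ nil) ↭-refl
           [ 1 ] (range x 4) (range y b) (range u t) S P P′ ⟩
    blocks 1 lengths
      ≡⟨ blocks≡range 1 lengths ⟩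
    range 1 (sum lengths) ∎
    where
    open PermutationReasoning
    X = concatMap members (nest 1 lo k)
    Y = concatMap members (nest 2 lo′ k)
    S = range 2 (k * 2)
    P = range lo (k * 2 + 1)
    P′ = range lo′ (k * 2 + 2)

threeBySix : ∀ t k → H2Exists (3 + t * 2) (6 + k * 4)
threeBySix t k =
  threeRowsEven t (six+ k) core triples spare (sum lengths) (size k)
    (cong (6 +_) (trans (cong (_* 2) count) (double k)))
    (col₁ z ∷ col₂ k ∷ col₃ k ∷ col₄ k ∷ col₅ k ∷ col₆ x ∷ [])
    (row₁ k ∷ row₂ x z ∷ row₃ k ∷ []) additive coreUses uses
  where
  open Layout k 1 0
  size : ∀ k → let N = 1 + (k * 2 + (4 + ((k * 2 + 1) + (1 + ((k * 2 + 2) + (0 + 0)))))) in N + N ≡ 3 * (6 + k * 4)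
  size = solve-∀
  double : ∀ k → (k + k) * 2 ≡ k * 4
  double = solve-∀
  core : List Column
  -- The layout gives `y = 2x + 3`, `z = g + x` and `2g = x + y + 3`; all row and column sums reduce
  -- to these relations.
  core = (neg 1 , neg z , pos (1 + z)) ∷ (neg g , neg (1 + x) , pos (1 + z)) ∷ (neg g , pos z , neg x)
       ∷ (pos (3 + x) , pos x , neg y) ∷ (pos y , neg (1 + x) , neg (2 + x)) ∷ (pos 1 , pos (2 + x) , neg (3 + x)) ∷ []
  coreUses : columnAbsolutes core ↭ spare ++ spare
  coreUses = solve 9 (λ o x₀ x₁ x₂ x₃ g y z₀ z₁ →
    let s = o ⊕ x₀ ⊕ x₁ ⊕ x₂ ⊕ x₃ ⊕ g ⊕ y ⊕ z₀ ⊕ z₁ in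
    o ⊕ z₀ ⊕ z₁ ⊕ g ⊕ x₁ ⊕ z₁ ⊕ g ⊕ z₀ ⊕ x₀ ⊕ x₃ ⊕ x₀ ⊕ y ⊕ y ⊕ x₁ ⊕ x₂ ⊕ o ⊕ x₂ ⊕ x₃ ⊜ s ⊕ s) ↭-refl
    [ 1 ] [ x ] [ 1 + x ] [ 2 + x ] [ 3 + x ] [ g ] [ y ] [ z ] [ 1 + z ]
  col₁ : ∀ z → (1 + z) + 0 ≡ 1 + (z + 0)
  col₁ = solve-∀
  col₂ : ∀ k → let x = 2 + k * 2 ; lo = x + 4 ; g = lo + k ; y = lo + (k * 2 + 1) ; z = y + 1 + k in
    (1 + z) + 0 ≡ g + ((1 + x) + 0)
  col₂ = solve-∀
  col₃ : ∀ k → let x = 2 + k * 2 ; lo = x + 4 ; g = lo + k ; y = lo + (k * 2 + 1) ; z = y + 1 + k in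
    z + 0 ≡ g + (x + 0)
  col₃ = solve-∀
  col₄ : ∀ k → let x = 2 + k * 2 ; y = x + 4 + (k * 2 + 1) in (3 + x) + (x + 0) ≡ y + 0
  col₄ = solve-∀
  col₅ : ∀ k → let x = 2 + k * 2 ; y = x + 4 + (k * 2 + 1) in y + 0 ≡ (1 + x) + ((2 + x) + 0)
  col₅ = solve-∀
  col₆ : ∀ x → 1 + ((2 + x) + 0) ≡ (3 + x) + 0
  col₆ = solve-∀
  row₁ : ∀ k → let x = 2 + k * 2 ; lo = x + 4 ; g = lo + k ; y = lo + (k * 2 + 1) in
    (3 + x) + (y + (1 + 0)) ≡ 1 + (g + (g + 0))
  row₁ = solve-∀
  row₂ : ∀ x z → z + (x + ((2 + x) + 0)) ≡ z + ((1 + x) + ((1 + x) + 0))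
  row₂ = solve-∀
  row₃ : ∀ k → let x = 2 + k * 2 ; y = x + 4 + (k * 2 + 1) ; z = y + 1 + k in
    (1 + z) + ((1 + z) + 0) ≡ x + (y + ((2 + x) + ((3 + x) + 0)))
  row₃ = solve-∀

threeByEight : ∀ t k → H2Exists (3 + t * 2) (8 + k * 4)
threeByEight t k =
  threeRowsEven t (eight+ k) core triples spare (sum lengths) (size k)
    (cong (8 +_) (trans (cong (_* 2) count) (double k)))
    (col₁ u ∷ col₂ k ∷ col₃ k ∷ col₄ z ∷ col₅ k ∷ col₆ k ∷ col₇ k ∷ col₈ k ∷ [])
    (row₁ g x y ∷ row₂ k ∷ row₃ k ∷ []) additive coreUses uses
  where
  open Layout k 2 2
  size : ∀ k → let N = 1 + (k * 2 + (4 + ((k * 2 + 1) + (2 + ((k * 2 + 2) + (2 + 0)))))) in N + N ≡ 3 * (8 + k * 4)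
  size = solve-∀
  double : ∀ k → (k + k) * 2 ≡ k * 4
  double = solve-∀
  core : List Column
  -- Here `y = 2x + 3`, `z = g + x + 1` and `u = x + y + 2`, whence `2z = u + y`; these relations
  -- give all row and column sums.
  core = (neg 1 , neg u , pos (1 + u)) ∷ (neg (2 + x) , neg (1 + y) , pos (1 + u)) ∷ (neg (1 + y) , neg (1 + x) , pos u)
       ∷ (pos 1 , pos z , neg (1 + z)) ∷ (neg g , pos (1 + z) , neg (2 + x)) ∷ (pos g , pos (1 + x) , neg z)
       ∷ (pos (3 + x) , pos x , neg y) ∷ (pos y , neg x , neg (3 + x)) ∷ []
  coreUses : columnAbsolutes core ↭ spare ++ spare
  coreUses = solve 12 (λ o x₀ x₁ x₂ x₃ g y₀ y₁ z₀ z₁ u₀ u₁ →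
    let s = o ⊕ x₀ ⊕ x₁ ⊕ x₂ ⊕ x₃ ⊕ g ⊕ y₀ ⊕ y₁ ⊕ z₀ ⊕ z₁ ⊕ u₀ ⊕ u₁ in
    o ⊕ u₀ ⊕ u₁ ⊕ x₂ ⊕ y₁ ⊕ u₁ ⊕ y₁ ⊕ x₁ ⊕ u₀ ⊕ o ⊕ z₀ ⊕ z₁ ⊕ g ⊕ z₁ ⊕ x₂ ⊕ g ⊕ x₁ ⊕ z₀
      ⊕ x₃ ⊕ x₀ ⊕ y₀ ⊕ y₀ ⊕ x₀ ⊕ x₃ ⊜ s ⊕ s) ↭-refl
    [ 1 ] [ x ] [ 1 + x ] [ 2 + x ] [ 3 + x ] [ g ] [ y ] [ 1 + y ] [ z ] [ 1 + z ] [ u ] [ 1 + u ]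
  col₁ : ∀ u → (1 + u) + 0 ≡ 1 + (u + 0)
  col₁ = solve-∀
  col₂ : ∀ k → let x = 2 + k * 2 ; y = x + 4 + (k * 2 + 1) ; u = y + 2 + (k * 2 + 2) in
    (1 + u) + 0 ≡ (2 + x) + ((1 + y) + 0)
  col₂ = solve-∀
  col₃ : ∀ k → let x = 2 + k * 2 ; y = x + 4 + (k * 2 + 1) ; u = y + 2 + (k * 2 + 2) in
    u + 0 ≡ (1 + y) + ((1 + x) + 0)
  col₃ = solve-∀
  col₄ : ∀ z → 1 + (z + 0) ≡ (1 + z) + 0
  col₄ = solve-∀
  col₅ : ∀ k → let x = 2 + k * 2 ; lo = x + 4 ; g = lo + k ; z = lo + (k * 2 + 1) + 2 + k in
    (1 + z) + 0 ≡ g + ((2 + x) + 0)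
  col₅ = solve-∀
  col₆ : ∀ k → let x = 2 + k * 2 ; lo = x + 4 ; g = lo + k ; z = lo + (k * 2 + 1) + 2 + k in
    g + ((1 + x) + 0) ≡ z + 0
  col₆ = solve-∀
  col₇ : ∀ k → let x = 2 + k * 2 ; y = x + 4 + (k * 2 + 1) in (3 + x) + (x + 0) ≡ y + 0
  col₇ = solve-∀
  col₈ : ∀ k → let x = 2 + k * 2 ; y = x + 4 + (k * 2 + 1) in y + 0 ≡ x + ((3 + x) + 0)
  col₈ = solve-∀
  row₁ : ∀ g x y → 1 + (g + ((3 + x) + (y + 0))) ≡ 1 + ((2 + x) + ((1 + y) + (g + 0)))
  row₁ = solve-∀
  row₂ : ∀ k → let x = 2 + k * 2 ; y = x + 4 + (k * 2 + 1) ; z = y + 2 + k ; u = y + 2 + (k * 2 + 2) in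
    z + ((1 + z) + ((1 + x) + (x + 0))) ≡ u + ((1 + y) + ((1 + x) + (x + 0)))
  row₂ = solve-∀
  row₃ : ∀ k → let x = 2 + k * 2 ; y = x + 4 + (k * 2 + 1) ; z = y + 2 + k ; u = y + 2 + (k * 2 + 2) in
    (1 + u) + ((1 + u) + (u + 0)) ≡ (1 + z) + ((2 + x) + (z + (y + ((3 + x) + 0))))
  row₃ = solve-∀

-- Both dimensions odd

-- The i-th triples (s, lo, hi) and (s+1, lo′, hi′) of the two nests exchange their first members;
-- the resulting defects ∓1 are absorbed by consecutive pairs.
fiveVectors : ∀ {v} q e lo lo′ z w k → Vectors v (5 + q * 4) (k * 2)
  ((concatMap members (nest e lo k) ++ concatMap members (nest (suc e) lo′ k))
    ++ range z (k * (2 + q * 4)) ++ range w (k * (2 + q * 4)))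
fiveVectors q e lo lo′ z w zero    = noVectors
fiveVectors {v} q e lo lo′ z w (suc k) =
  reorder uses
    (addPadded A (2 + z) q (0 , 0 , sumA (k * 2) e lo′ z)
      (addPadded B (2 + w) q (0 , 0 , sumB (k * 2) e lo w)
        (fiveVectors q e (suc lo) (suc lo′) (z + (2 + q * 4)) (w + (2 + q * 4)) k)))
  where
  s = suc (k * 2 + e)
  s′ = suc (k * 2 + suc e)
  hi = suc (lo + (k * 2 + e))
  hi′ = suc (lo′ + (k * 2 + suc e))
  A B : Row
  A = pos s ∷ pos lo′ ∷ neg hi′ ∷ neg z ∷ pos (suc z) ∷ []
  B = pos s′ ∷ pos lo ∷ neg hi ∷ pos w ∷ neg (suc w) ∷ []
  sumA : ∀ x e lo′ z → suc (x + e) + (lo′ + (suc z + 0)) + 0 ≡ suc (lo′ + (x + suc e)) + (z + 0) + 0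
  sumA = solve-∀
  sumB : ∀ x e lo w → suc (x + suc e) + (lo + (w + 0)) + 0 ≡ suc (lo + (x + e)) + (suc w + 0) + 0
  sumB = solve-∀
  b = 2 + q * 4
  X = concatMap members (nest e (suc lo) k)
  Y = concatMap members (nest (suc e) (suc lo′) k)
  Z = range (z + b) (k * b)
  W = range (w + b) (k * b)
  Q = range (2 + z) (q * 4)
  R = range (2 + w) (q * 4)
  uses : (map ∣_∣ A ++ Q) ++ (map ∣_∣ B ++ R) ++ ((X ++ Y) ++ Z ++ W)
    ↭ ((s ∷ lo ∷ hi ∷ X) ++ (s′ ∷ lo′ ∷ hi′ ∷ Y)) ++ range z (b + k * b) ++ range w (b + k * b)
  uses = begin
    (map ∣_∣ A ++ Q) ++ (map ∣_∣ B ++ R) ++ ((X ++ Y) ++ Z ++ W)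
      ↭⟨ solve 14 (λ s lo hi s′ lo′ hi′ zz ww X Y Z W Q R →
           ((s ⊕ lo′ ⊕ hi′ ⊕ zz) ⊕ Q) ⊕ ((s′ ⊕ lo ⊕ hi ⊕ ww) ⊕ R) ⊕ ((X ⊕ Y) ⊕ Z ⊕ W)
           ⊜ ((s ⊕ lo ⊕ hi ⊕ X) ⊕ (s′ ⊕ lo′ ⊕ hi′ ⊕ Y)) ⊕ ((zz ⊕ Q) ⊕ Z) ⊕ ((ww ⊕ R) ⊕ W)) ↭-refl
           [ s ] [ lo ] [ hi ] [ s′ ] [ lo′ ] [ hi′ ] (range z 2) (range w 2) X Y Z W Q R ⟩
    ((s ∷ lo ∷ hi ∷ X) ++ (s′ ∷ lo′ ∷ hi′ ∷ Y)) ++ (range z b ++ Z) ++ (range w b ++ W)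
      ≡⟨ cong₂ (λ F G → ((s ∷ lo ∷ hi ∷ X) ++ (s′ ∷ lo′ ∷ hi′ ∷ Y)) ++ F ++ G) (range-++ z b (k * b)) (range-++ w b (k * b)) ⟨
    ((s ∷ lo ∷ hi ∷ X) ++ (s′ ∷ lo′ ∷ hi′ ∷ Y)) ++ range z (b + k * b) ++ range w (b + k * b) ∎
    where open PermutationReasoning

-- Each of the two nests has `p` outer and `q` inner pairs. The outer triples go to the paired rows
-- through `fiveVectors`, the inner ones to the columns of the three rows. The core takes 1, 2, the
-- gaps `c … c + 2` and `d , d + 1`, and once the number `h`, which is half of `v`.
oddByOdd : ∀ p q → H2Exists (3 + p * 2 * 2) (5 + q * 4)
oddByOdd p q =
  threeRows core triples spare [ h ] N (size p q)
    (cong (5 +_) (trans (cong (_* 2) count) (double q)))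
    (col₁ p q ∷ col₂ d ∷ col₃ d ∷ col₄ c ∷ col₅ c ∷ [])
    (row₁ c d ∷ row₂ c d ∷ row₃ p q ∷ [])
    (Allₚ.++⁺ (nest-additive 2 (lo + p) q) (nest-additive 3 (lo′ + p) q))
    (fiveVectors q e lo lo′ z w p)
    coreUses uses (twoFold-even N)
  where
  e = q * 2 + 2
  f = p * (2 + q * 4)
  lengths : List ℕ
  lengths = 2 ∷ q * 2 ∷ p * 2 ∷ f ∷ p * 2 + suc e ∷ p * 2 + e ∷ f ∷ []
  N = sum lengths
  h = suc N
  z = 3 + q * 2 + p * 2
  lo′ = z + f
  lo = lo′ + (p * 2 + suc e)
  w = lo + (p * 2 + e)
  c = lo′ + p + q
  d = lo + p + q
  triples : List Triple
  triples = nest 2 (lo + p) q ++ nest 3 (lo′ + p) q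
  count : length triples ≡ q + q
  count = trans (length-++ (nest 2 (lo + p) q)) (cong₂ _+_ (length-nest 2 (lo + p) q) (length-nest 3 (lo′ + p) q))
  double : ∀ q → (q + q) * 2 ≡ q * 4
  double = solve-∀
  size : ∀ p q →
    let e = q * 2 + 2 ; f = p * (2 + q * 4)
        N = 2 + (q * 2 + (p * 2 + (f + ((p * 2 + suc e) + ((p * 2 + e) + (f + 0))))))
    in suc N + suc N ≡ suc ((3 + p * 2 * 2) * (5 + q * 4))
  size = solve-∀
  core : List Column
  -- The intervals are ordered so that `h` is twice the centre `1 + c` of the gap of length 3. The
  -- first column and the third row depend on this.
  core = (neg (1 + c) , neg (1 + c) , pos h) ∷ (neg (1 + d) , pos d , pos 1) ∷ (pos d , neg (1 + d) , pos 1)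
       ∷ (pos 2 , pos c , neg (2 + c)) ∷ (pos c , pos 2 , neg (2 + c)) ∷ []
  spare : List ℕ
  spare = range 1 2 ++ range c 3 ++ range d 2
  coreUses : columnAbsolutes core ↭ spare ++ spare ++ [ h ]
  coreUses = solve 8 (λ o t c₀ c₁ c₂ d₀ d₁ h →
    let s = o ⊕ t ⊕ c₀ ⊕ c₁ ⊕ c₂ ⊕ d₀ ⊕ d₁ in
    c₁ ⊕ c₁ ⊕ h ⊕ d₁ ⊕ d₀ ⊕ o ⊕ d₀ ⊕ d₁ ⊕ o ⊕ t ⊕ c₀ ⊕ c₂ ⊕ c₀ ⊕ t ⊕ c₂ ⊜ s ⊕ s ⊕ h) ↭-refl
    [ 1 ] [ 2 ] [ c ] [ 1 + c ] [ 2 + c ] [ d ] [ 1 + d ] [ h ]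
  col₁ : ∀ p q →
    let e = q * 2 + 2 ; f = p * (2 + q * 4)
        N = 2 + (q * 2 + (p * 2 + (f + ((p * 2 + suc e) + ((p * 2 + e) + (f + 0))))))
        c = 3 + q * 2 + p * 2 + f + p + q
    in suc N + 0 ≡ (1 + c) + ((1 + c) + 0)
  col₁ = solve-∀
  col₂ : ∀ d → d + (1 + 0) ≡ (1 + d) + 0
  col₂ = solve-∀
  col₃ : ∀ d → d + (1 + 0) ≡ (1 + d) + 0
  col₃ = solve-∀
  col₄ : ∀ c → 2 + (c + 0) ≡ (2 + c) + 0
  col₄ = solve-∀
  col₅ : ∀ c → c + (2 + 0) ≡ (2 + c) + 0
  col₅ = solve-∀
  row₁ : ∀ c d → d + (2 + (c + 0)) ≡ (1 + c) + ((1 + d) + 0)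
  row₁ = solve-∀
  row₂ : ∀ c d → d + (c + (2 + 0)) ≡ (1 + c) + ((1 + d) + 0)
  row₂ = solve-∀
  row₃ : ∀ p q →
    let e = q * 2 + 2 ; f = p * (2 + q * 4)
        N = 2 + (q * 2 + (p * 2 + (f + ((p * 2 + suc e) + ((p * 2 + e) + (f + 0))))))
        c = 3 + q * 2 + p * 2 + f + p + q
    in suc N + (1 + (1 + 0)) ≡ (2 + c) + ((2 + c) + 0)
  row₃ = solve-∀

  X Y X′ Y′ F G S S′ : List ℕ
  X = concatMap members (nest 2 (lo + p) q)
  Y = concatMap members (nest 3 (lo′ + p) q)
  X′ = concatMap members (nest e lo p)
  Y′ = concatMap members (nest (suc e) lo′ p)
  F = range z f
  G = range w f
  S = range 3 (q * 2)
  S′ = range (3 + q * 2) (p * 2)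
  uses : spare ++ concatMap members triples ++ ((X′ ++ Y′) ++ F ++ G) ↭ range 1 N
  uses = begin
    spare ++ concatMap members triples ++ ((X′ ++ Y′) ++ F ++ G)
      ≡⟨ cong (λ T → spare ++ T ++ ((X′ ++ Y′) ++ F ++ G)) (concatMap-++ members (nest 2 (lo + p) q) (nest 3 (lo′ + p) q)) ⟩
    (range 1 2 ++ range c 3 ++ range d 2) ++ (X ++ Y) ++ ((X′ ++ Y′) ++ F ++ G)
      ↭⟨ solve 9 (λ o c d X Y X′ Y′ F G → (o ⊕ c ⊕ d) ⊕ (X ⊕ Y) ⊕ ((X′ ⊕ Y′) ⊕ F ⊕ G)
           ⊜ (o ⊕ F ⊕ G ⊕ X′ ⊕ Y′) ⊕ (X ⊕ Y ⊕ d ⊕ c)) ↭-refl (range 1 2) (range c 3) (range d 2) X Y X′ Y′ F G ⟩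
    (range 1 2 ++ F ++ G ++ X′ ++ Y′) ++ (X ++ Y ++ range d 2 ++ range c 3)
      -- The inner nests with their gaps filled are exactly the gaps, of length `e` and `suc e`, of
      -- the outer nests, so `two-nests` applies a second time.
      ↭⟨ ↭ₚ.++⁺ˡ (range 1 2 ++ F ++ G ++ X′ ++ Y′) (two-nests 2 (lo + p) (lo′ + p) q) ⟩
    (range 1 2 ++ F ++ G ++ X′ ++ Y′) ++ (S ++ range (lo + p) e ++ range (lo′ + p) (q * 2 + 3))
      ≡⟨ cong (λ l → (range 1 2 ++ F ++ G ++ X′ ++ Y′) ++ (S ++ range (lo + p) e ++ range (lo′ + p) l)) (+-suc (q * 2) 2) ⟩
    (range 1 2 ++ F ++ G ++ X′ ++ Y′) ++ (S ++ range (lo + p) e ++ range (lo′ + p) (suc e))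
      ↭⟨ solve 8 (λ o F G X′ Y′ S A B → (o ⊕ F ⊕ G ⊕ X′ ⊕ Y′) ⊕ (S ⊕ A ⊕ B) ⊜ (o ⊕ F ⊕ G ⊕ S) ⊕ (X′ ⊕ Y′ ⊕ A ⊕ B)) ↭-refl
           (range 1 2) F G X′ Y′ S (range (lo + p) e) (range (lo′ + p) (suc e)) ⟩
    (range 1 2 ++ F ++ G ++ S) ++ (X′ ++ Y′ ++ range (lo + p) e ++ range (lo′ + p) (suc e))
      ↭⟨ ↭ₚ.++⁺ˡ (range 1 2 ++ F ++ G ++ S) (two-nests e lo lo′ p) ⟩
    (range 1 2 ++ F ++ G ++ S) ++ (range (suc e) (p * 2) ++ range lo (p * 2 + e) ++ range lo′ (p * 2 + suc e))
      ≡⟨ cong (λ a → (range 1 2 ++ F ++ G ++ S) ++ (range (suc a) (p * 2) ++ range lo (p * 2 + e) ++ range lo′ (p * 2 + suc e)))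
           (+-comm (q * 2) 2) ⟩
    (range 1 2 ++ F ++ G ++ S) ++ (S′ ++ range lo (p * 2 + e) ++ range lo′ (p * 2 + suc e))
      ↭⟨ solve 7 (λ o F G S S′ P P′ → (o ⊕ F ⊕ G ⊕ S) ⊕ (S′ ⊕ P ⊕ P′) ⊜ o ⊕ S ⊕ S′ ⊕ F ⊕ P′ ⊕ P ⊕ G ⊕ nil) ↭-refl
           (range 1 2) F G S S′ (range lo (p * 2 + e)) (range lo′ (p * 2 + suc e)) ⟩
    blocks 1 lengths
      ≡⟨ blocks≡range 1 lengths ⟩
    range 1 N ∎
    where open PermutationReasoning

-- Necessity

sum-parity : ∀ k {f g : Fin k → ℕ} → (∀ i → f i % 2 ≡ g i % 2) → sumFin k f % 2 ≡ sumFin k g % 2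
sum-parity zero            f≈g = refl
sum-parity (suc k) {f} {g} f≈g = begin
  (f zero + sumFin k (f ∘ suc)) % 2              ≡⟨ %-distribˡ-+ (f zero) _ 2 ⟩
  (f zero % 2 + sumFin k (f ∘ suc) % 2) % 2      ≡⟨ cong₂ (λ a b → (a + b) % 2) (f≈g zero) (sum-parity k (f≈g ∘ suc)) ⟩
  (g zero % 2 + sumFin k (g ∘ suc) % 2) % 2      ≡⟨ %-distribˡ-+ (g zero) _ 2 ⟨
  (g zero + sumFin k (g ∘ suc)) % 2              ∎
  where open ≡-Reasoning

parity-of-sum : ∀ k (f : Fin k → ℕ) → sumFin k (λ i → f i % 2) % 2 ≡ sumFin k f % 2
parity-of-sum k f = sum-parity k (λ i → m%n%n≡m%n (f i) 2)

odd : ∀ {h} → Fin h → ℕ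
odd i = suc (toℕ i * 2)

odd< : ∀ {h} (i : Fin h) → odd i < h * 2
odd< i = *-monoˡ-≤ 2 (toℕ<n i)

-- Summed over all odd residues, the test for equality becomes an indicator of odd entries.
count-odd : ∀ h a → a < h * 2 → sumFin h (λ i → [ a ≈ odd i ]) ≡ a % 2
count-odd (suc h) 0             _               = sumFin-0 h
count-odd (suc h) 1             _               = cong suc (sumFin-0 h)
count-odd (suc h) (suc (suc a)) (s≤s (s≤s a<h)) = count-odd h a a<h

complement-parity : ∀ a b h → b + a ≡ h * 2 → b % 2 ≡ a % 2
complement-parity a b h eq = begin
  b % 2             ≡⟨ [m+kn]%n≡m%n b a 2 ⟨
  (b + a * 2) % 2   ≡⟨ cong (_% 2) (lem a b) ⟩
  (a + (b + a)) % 2 ≡⟨ cong (λ x → (a + x) % 2) eq ⟩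
  (a + h * 2) % 2   ≡⟨ [m+kn]%n≡m%n a h 2 ⟩
  a % 2             ∎
  where
  open ≡-Reasoning
  lem : ∀ a b → b + a * 2 ≡ a + (b + a)
  lem = solve-∀

-- Negation modulo an even `v` preserves parity, so the tests for `-y` count the odd entries as
-- well.
count-odd-neg : ∀ h {v} .{{_ : NonZero v}} → v ≡ h * 2 → ∀ a → a < v →
  sumFin h (λ i → [ (a + odd i) % v ≈ 0 ]) ≡ a % 2
count-odd-neg h {v} v≡ zero _ =
  -- The entry 0 is separate because `v ∸ 0` is `v`, outside the bound of `count-odd`.
  trans (sumFin-cong h (λ i → ≈-false (λ e →
    1+n≢0 (trans (sym (m<n⇒m%n≡m (subst (odd i <_) (sym v≡) (odd< i)))) e))))
    (sumFin-0 h)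
count-odd-neg h {v} v≡ a@(suc _) a<v = begin
  sumFin h (λ i → [ (a + odd i) % v ≈ 0 ])  ≡⟨ sumFin-cong h (λ i → cong (λ b → if b then 1 else 0) (flip i)) ⟩
  sumFin h (λ i → [ v ∸ a ≈ odd i ])        ≡⟨ count-odd h (v ∸ a) (subst (v ∸ a <_) v≡ (∸-monoʳ-< (s≤s z≤n) (<⇒≤ a<v))) ⟩
  (v ∸ a) % 2                               ≡⟨ complement-parity a (v ∸ a) h (trans (m∸n+n≡m (<⇒≤ a<v)) v≡) ⟩
  a % 2                                     ∎
  where
  open ≡-Reasoning
  flip : (i : Fin h) → (((a + odd i) % v) ≡ᵇ 0) ≡ (v ∸ a ≡ᵇ odd i)
  flip i = trans
    (%-zero (s≤s z≤n) (+-mono-< a<v (subst (odd i <_) (sym v≡) (odd< i))))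
    (≡ᵇ-cong (a + odd i) v (v ∸ a) (odd i)
      (λ { e → trans (cong (_∸ a) (sym e)) (m+n∸m≡n a (odd i)) })
      (λ e → trans (cong (a +_) (sym e)) (m+[n∸m]≡n (<⇒≤ a<v))))

sumFin-2 : ∀ k → sumFin k (λ _ → 2) ≡ k * 2
sumFin-2 zero    = refl
sumFin-2 (suc k) = cong (2 +_) (sumFin-2 k)

sumFin-swap₃ : ∀ h m n (f : Fin h → Fin m → Fin n → ℕ) →
  sumFin h (λ y → sumFin m (λ i → sumFin n (f y i))) ≡ sumFin m (λ i → sumFin n (λ j → sumFin h (λ y → f y i j)))
sumFin-swap₃ h m n f =
  trans (sumFin-swap h m (λ y i → sumFin n (f y i))) (sumFin-cong m (λ i → sumFin-swap h n (λ y → f y i)))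

-- Summing the covering condition over the odd residues shows that exactly v / 2 entries are odd.
half-odd : ∀ {m n h} (A : Array m n) → IsH2 m n A → suc (m * n) ≡ h * 2 →
  sumFin m (λ i → sumFin n (λ j → A i j % 2)) ≡ h
half-odd {m} {n} {h} A isH2 v≡ = *-cancelʳ-≡ K h 2 (begin
  K * 2                      ≡⟨ lem K ⟩
  K + K                      ≡⟨ cong₂ _+_ eqs negs ⟨
  sumFin h (λ i → countEq m n v A (odd i)) + sumFin h (λ i → countNeg m n v A (odd i))
    ≡⟨ sumFin-+ h _ _ ⟩
  sumFin h (λ i → countEq m n v A (odd i) + countNeg m n v A (odd i))
    ≡⟨ sumFin-cong h (λ i → covering (odd i) (s≤s z≤n) (subst (odd i <_) (sym v≡) (odd< i))) ⟩
  sumFin h (λ _ → 2)         ≡⟨ sumFin-2 h ⟩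
  h * 2                      ∎)
  where
  open IsH2 isH2
  open ≡-Reasoning
  v = suc (m * n)
  K = sumFin m (λ i → sumFin n (λ j → A i j % 2))
  lem : ∀ k → k * 2 ≡ k + k
  lem = solve-∀
  eqs : sumFin h (λ i → countEq m n v A (odd i)) ≡ K
  eqs = trans (sumFin-swap₃ h m n (λ y i j → [ A i j ≈ odd y ]))
    (sumFin-cong m (λ i → sumFin-cong n (λ j → count-odd h (A i j) (subst (A i j <_) v≡ (entries< i j)))))
  negs : sumFin h (λ i → countNeg m n v A (odd i)) ≡ K
  negs = trans (sumFin-swap₃ h m n (λ y i j → [ (A i j + odd y) % v ≈ 0 ]))
    (sumFin-cong m (λ i → sumFin-cong n (λ j → count-odd-neg h v≡ (A i j) (entries< i j))))

-- A row sum is a multiple of the even number `v`, so every row has an even number of odd entries,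
-- whereas their total `h = 1 + 2k` is odd.
mn≢1mod4 : ∀ {m n} → H2Exists m n → ¬ (m * n) % 4 ≡ 1
mn≢1mod4 {m} {n} (A , isH2) mn≡1 = 0≢1+n (begin
  0                                              ≡⟨ cong (_% 2) (sumFin-0 m) ⟨
  sumFin m (λ _ → 0) % 2                         ≡⟨ sum-parity m rowEven ⟨
  sumFin m (λ i → sumFin n (λ j → A i j % 2)) % 2  ≡⟨ cong (_% 2) (half-odd {h = h} A isH2 v≡) ⟩
  h % 2                                          ≡⟨ [m+kn]%n≡m%n 1 k 2 ⟩
  1                                              ∎)
  where
  open IsH2 isH2
  open ≡-Reasoning
  k = (m * n) / 4
  h = 1 + k * 2
  v≡ : suc (m * n) ≡ h * 2
  v≡ = trans (cong suc (trans (m≡m%n+[m/n]*n (m * n) 4) (cong (_+ k * 4) mn≡1))) (lem k)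
    where
    lem : ∀ k → suc (1 + k * 4) ≡ (1 + k * 2) * 2
    lem = solve-∀
  rowEven : ∀ i → sumFin n (λ j → A i j % 2) % 2 ≡ 0
  rowEven i = begin
    sumFin n (λ j → A i j % 2) % 2      ≡⟨ parity-of-sum n (A i) ⟩
    s % 2                               ≡⟨ cong (_% 2) (trans (m≡m%n+[m/n]*n s v) (cong (_+ s / v * v) (rowSum i))) ⟩
    (s / v * v) % 2                     ≡⟨ cong (λ x → (s / v * x) % 2) v≡ ⟩
    (s / v * (h * 2)) % 2               ≡⟨ cong (_% 2) (*-assoc (s / v) h 2) ⟨
    (s / v * h * 2) % 2                 ≡⟨ m*n%n≡0 (s / v * h) 2 ⟩
    0                                   ∎
    where
    s = sumFin n (A i)
    v = suc (m * n)

-- The zero sums force the entries `a`, `-a`, `-a`, `a`, so 1 is covered four times or never. The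
-- proof checks all quadruples of residues modulo 5.
¬H2-2-2 : ¬ H2Exists 2 2
¬H2-2-2 (A , isH2) =
  refute (entries< zero zero) (entries< zero (suc zero)) (entries< (suc zero) zero) (entries< (suc zero) (suc zero))
    (rowSum zero) (rowSum (suc zero)) (colSum zero) (covering 1 (s≤s z≤n) (s≤s (s≤s z≤n)))
  where
  open IsH2 isH2
  grid : ℕ → ℕ → ℕ → ℕ → Array 2 2
  grid a b c d zero       zero       = a
  grid a b c d zero       (suc zero) = b
  grid a b c d (suc zero) zero       = c
  grid a b c d (suc zero) (suc zero) = d
  Impossible : ℕ → ℕ → ℕ → ℕ → Set
  Impossible a b c d =
    (a + (b + 0)) % 5 ≡ 0 → (c + (d + 0)) % 5 ≡ 0 → (a + (c + 0)) % 5 ≡ 0 →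
    ¬ countEq 2 2 5 (grid a b c d) 1 + countNeg 2 2 5 (grid a b c d) 1 ≡ 2
  impossible? : ∀ a b c d → Dec (Impossible a b c d)
  impossible? a b c d =
    ((a + (b + 0)) % 5 ≟ 0) →-dec (((c + (d + 0)) % 5 ≟ 0) →-dec (((a + (c + 0)) % 5 ≟ 0) →-dec
      ¬? (countEq 2 2 5 (grid a b c d) 1 + countNeg 2 2 5 (grid a b c d) 1 ≟ 2)))
  exhaustive : (a b c d : Fin 5) → Impossible (toℕ a) (toℕ b) (toℕ c) (toℕ d)
  exhaustive = from-yes (all? {n = 5} λ a → all? {n = 5} λ b → all? {n = 5} λ c → all? {n = 5} λ d →
    impossible? (toℕ a) (toℕ b) (toℕ c) (toℕ d))
  refute : ∀ {a b c d} → a < 5 → b < 5 → c < 5 → d < 5 → Impossible a b c d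
  refute {a} {b} {c} {d} a< b< c< d< =
    subst₂ (λ a b → Impossible a b c d) (toℕ-fromℕ< a<) (toℕ-fromℕ< b<)
      (subst₂ (Impossible (toℕ (fromℕ< a<)) (toℕ (fromℕ< b<))) (toℕ-fromℕ< c<) (toℕ-fromℕ< d<)
        (exhaustive (fromℕ< a<) (fromℕ< b<) (fromℕ< c<) (fromℕ< d<)))

-- Sufficiency

-- The residue modulo 4 selects the construction. The number 2 is separate because two rows need a
-- construction of their own.
data Size : ℕ → Set where
  two   : Size 2
  even  : ∀ {n} → EvenWidth n → Size n
  odd₃  : ∀ k → Size (3 + k * 4)
  odd₅  : ∀ k → Size (5 + k * 4)

size : ∀ n → 2 ≤ n → Size n
size 1 (s≤s ())
size 2 _ = two
size 3 _ = odd₃ 0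
size 4 _ = even four
size 5 _ = odd₅ 0
size (suc (suc (suc (suc n@(suc (suc _)))))) _ = step (size n (s≤s (s≤s z≤n)))
  where
  step : ∀ {n} → Size n → Size (4 + n)
  step two                = even (six+ 0)
  step (even four)        = even (eight+ 0)
  step (even (six+ k))    = even (six+ (suc k))
  step (even (eight+ k))  = even (eight+ (suc k))
  step (odd₃ k)           = odd₃ (suc k)
  step (odd₅ k)           = odd₅ (suc k)

4k : ∀ k → k * 2 * 2 ≡ k * 4
4k k = *-assoc k 2 2

-- With `t` even or odd, `3 + t * 2` covers both odd residue classes modulo 4 except the number 1.
threeByEven : ∀ t {n} → EvenWidth n → H2Exists (3 + t * 2) n
threeByEven t four       = threeByFour t
threeByEven t (six+ k)   = threeBySix t k
threeByEven t (eight+ k) = threeByEight t k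

odd₃ByEven : ∀ k {n} → EvenWidth n → H2Exists (3 + k * 4) n
odd₃ByEven k {n} w = subst (λ x → H2Exists (3 + x) n) (4k k) (threeByEven (k * 2) w)

odd₅ByEven : ∀ k {n} → EvenWidth n → H2Exists (5 + k * 4) n
odd₅ByEven k {n} w = subst (λ x → H2Exists (5 + x) n) (4k k) (threeByEven (1 + k * 2) w)

odd₃ByOdd₅ : ∀ p q → H2Exists (3 + p * 4) (5 + q * 4)
odd₃ByOdd₅ p q = subst (λ x → H2Exists (3 + x) (5 + q * 4)) (4k p) (oddByOdd p q)

evenWidth-half : ∀ {m} → EvenWidth m → ∃ λ t → t * 2 ≡ m
evenWidth-half four       = 2 , refl
evenWidth-half (six+ k)   = 3 + k * 2 , cong (6 +_) (4k k)
evenWidth-half (eight+ k) = 4 + k * 2 , cong (8 +_) (4k k)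

-- Two odd numbers of the same class modulo 4 have product 1 modulo 4, so `oddByOdd` is needed only
-- for different classes. Transposition brings the remaining pairs into a constructed order.
construct : ∀ {m n} → Size m → Size n → ¬ (m * n) % 4 ≡ 1 → ¬ (m ≡ 2 × n ≡ 2) → H2Exists m n
construct two      two      _ ¬22 = ⊥-elim (¬22 (refl , refl))
construct two      (even w) _ _   = evenByEven 1 w
construct two      (odd₃ q) _ _   = twoByOdd₃ q
construct two      (odd₅ q) _ _   = twoByOdd₅ q
construct (even w) two      _ _   = transposeH2 (evenByEven 1 w)
construct (even w) (even x) _ _   with evenWidth-half w
... | t , refl = evenByEven t x
construct (even w) (odd₃ q) _ _   = transposeH2 (odd₃ByEven q w)
construct (even w) (odd₅ q) _ _   = transposeH2 (odd₅ByEven q w)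
construct (odd₃ p) two      _ _   = transposeH2 (twoByOdd₃ p)
construct (odd₃ p) (even w) _ _   = odd₃ByEven p w
construct (odd₃ p) (odd₃ q) ¬1 _  = ⊥-elim (¬1 (trans (cong (_% 4) (lem p q)) ([m+kn]%n≡m%n 1 (2 + p * 3 + q * 3 + p * q * 4) 4)))
  where
  lem : ∀ p q → (3 + p * 4) * (3 + q * 4) ≡ 1 + (2 + p * 3 + q * 3 + p * q * 4) * 4
  lem = solve-∀
construct (odd₃ p) (odd₅ q) _ _   = odd₃ByOdd₅ p q
construct (odd₅ p) two      _ _   = transposeH2 (twoByOdd₅ p)
construct (odd₅ p) (even w) _ _   = odd₅ByEven p w
construct (odd₅ p) (odd₃ q) _ _   = transposeH2 (odd₃ByOdd₅ q p)
construct (odd₅ p) (odd₅ q) ¬1 _  = ⊥-elim (¬1 (trans (cong (_% 4) (lem p q)) ([m+kn]%n≡m%n 1 (6 + p * 5 + q * 5 + p * q * 4) 4)))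
  where
  lem : ∀ p q → (5 + p * 4) * (5 + q * 4) ≡ 1 + (6 + p * 5 + q * 5 + p * q * 4) * 4
  lem = solve-∀

theorem4p12 : (m n : ℕ) → 2 ≤ m → 2 ≤ n →
    H2Exists m n ⇔ ((¬ ((m * n) % 4 ≡ 1)) × (¬ ((m ≡ 2) × (n ≡ 2))))
theorem4p12 m n 2≤m 2≤n = mk⇔
  (λ H → mn≢1mod4 H , λ { (refl , refl) → ¬H2-2-2 H })
  (λ { (¬1 , ¬22) → construct (size m 2≤m) (size n 2≤n) ¬1 ¬22 })
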